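{- Let $\mathcal A$ be a class of structures, let $\mathcal G$ denote $\{\mathrm{graph}(\mathrm{core}(\mathbf A))\mid\mathbf A\in\mathcal A\}$, and let $r\ge0$. The following are equivalent. 1. There exists a game vector $v$ with $r+1$ rounds such that the $v$-game solves $p\text{ - }\mathrm{HOM}(\mathcal A)$. 2. $\mathcal G\preceq\mathcal F_r$. 3. The class $\mathcal G$ has bounded tree depth and has stack depth $\le r$.
   Context: Structures are finite relational structures over finite vocabularies with non-empty universe; similar structures have the same vocabulary. A partial homomorphism from $\mathbf A$ to $\mathbf B$ is either the empty map or a homomorphism to $\mathbf B$ from the substructure of $\mathbf A$ induced on a non-empty set $\mathrm{dom}(h)\subseteq A$. A structure is a core if all its homomorphisms to itself are injective; $\mathrm{core}(\mathbf A)$ is the (unique up to isomorphism) core $\mathbf B$ with $B\subseteq A$, $R^{\mathbf B}\subseteq R^{\mathbf A}$ for all $R$, and such that $\mathbf A$ has a homomorphism to $\mathbf B$. $\mathrm{graph}(\mathbf A)$ is the Gaifman graph: vertex set $A$, an edge between distinct $a,a'$ iff they occur together in a tuple of some relation of $\mathbf A$. A game vector is a tuple $v=(p_1,\ldots,p_m)\in\mathbb N^m$ with $m\ge1$; it has $m$ rounds. A Duplicator winning strategy for the $v$-game on a pair $(\mathbf A,\mathbf B)$ of similar structures is a sequence $(W_1,\ldots,W_m)$ of sets of partial homomorphisms from $\mathbf A$ to $\mathbf B$ such that: for all $S\subseteq A$ with $|S|\le p_1$, $W_1$ contains a mapping with domain $S$; and for all $1\le i\le m-1$, all $g\in W_i$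 and all $S$ with $\mathrm{dom}(g)\subseteq S\subseteq A$ and $|S\setminus\mathrm{dom}(g)|\le p_{i+1}$, there is an extension $g'\in W_{i+1}$ of $g$ with domain $S$. The $v$-game solves $p\text{ - }\mathrm{HOM}(\mathcal A)$ if for every $\mathbf A\in\mathcal A$ and every $\mathbf B$ similar to $\mathbf A$, the existence of a Duplicator winning strategy for the $v$-game on $(\mathbf A,\mathbf B)$ implies that there is a homomorphism from $\mathbf A$ to $\mathbf B$. Graphs are finite, simple, undirected, with non-empty vertex set; $\mathrm{refl}(E^{\mathbf G})=E^{\mathbf G}\cup\{(g,g)\mid g\in G\}$. An $\mathbf H$-deconstruction of $\mathbf G$ is a family $(B_h)_{h\in H}$ of subsets of $G$ such that for each $(g,g')\in\mathrm{refl}(E^{\mathbf G})$ there is $(h,h')\in\mathrm{refl}(E^{\mathbf H})$ with $\{g,g'\}\subseteq B_h\cup B_{h'}$, and for each $g\in G$ the set $\{h\mid g\in B_h\}$ is connected in $\mathbf H$; its width is $\max_{(h,h')\in\mathrm{refl}(E^{\mathbf H})}|B_h\cup B_{h'}|$. $\mathcal G\preceq\mathcal H$ means there is a constant $k\ge1$ such that every $\mathbf G\in\mathcal G$ has an $\mathbf H$-deconstruction of width $\le k$ for some $\mathbf H\in\mathcal H$. The height of a rooted tree is the maximum number of edges on a path from the root to a vertex; the height of a tree is the minimum height over all rootings; the height of a forest is the maximum height of its components; $\mathcal F_r$ is the class of forests of height at most $r$. The tree depth of a connected graph $\mathbf G$ is the least $h$ such that there is a rooted tree on vertex set $G$ of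 height $\le h$ such that for every edge of $\mathbf G$ one endpoint is an ancestor of the other; the tree depth of a graph is the maximum over its components; a class has bounded tree depth if its members' tree depths have a common upper bound. For $h\ge0,k\ge1$, $\mathbf T_{h,k}$ is the tree whose vertices are the strings of length $\le h$ over $\{1,\dots,k\}$, with an edge between $t$ and $ti$ for each string $t$ of length $<h$ and $i\in\{1,\dots,k\}$. The stack depth of $\mathcal G$ is $\max\{h\mid\forall k\ge1:\mathbf T_{h,k}\text{ is a minor of some graph in }\mathcal G\}$ ($\infty$ if this set is infinite). -}

module Defs where

open import Data.Fin using (Fin; zero; suc; inject₁; fromℕ)
open import Data.Fin.Subset using (Subset; _∈_; _⊆_; _∪_; _∩_; _─_; ∣_∣; Nonempty; Empty; ⊥)
open import Data.List using (length; _∷ʳ_)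
open import Data.List.Properties using (length-++-sucʳ; ++-identityʳ)
open import Data.Maybe using (Maybe; just; is-just)
open import Data.Nat using (ℕ; zero; suc; _≤_; NonZero)
open import Data.Nat.Properties using (1+n≢n)
open import Data.Product using (Σ; ∃; ∃₂; _×_; _,_; proj₁; proj₂)
open import Data.Sum using (_⊎_; inj₁; inj₂; swap)
open import Data.Vec as Vec using (Vec; lookup; tabulate)
open import Data.Vec.Bounded using (Vec≤; toList)
import Data.Vec.Membership.Propositional as VecMembership
open import Function using (_∘_)
open import Function.Definitions using (Injective)
open import Level using (Level; 0ℓ) renaming (_⊔_ to _⊔ˡ_; suc to lsuc)
open import Relation.Binary using (Rel; Symmetric; Irreflexive)
open import Relation.Binary.Construct.Closure.Reflexive using (ReflClosure)
open import Relation.Binary.Construct.Closure.ReflexiveTransitive using (Star)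
open import Relation.Binary.PropositionalEquality using (_≡_; _≢_; refl; sym; trans; cong; ≢-sym)
open import Relation.Nullary using (¬_)
open import Relation.Unary using (Pred)

private
  variable
    ℓ : Level
    m n : ℕ

------------------------------------------------------------------------
-- Relational structures

record Vocabulary : Set where
  field
    symbols : ℕ
    arity   : Fin symbols → ℕ

open Vocabulary public

-- Finite universes are taken to be Fin size. All notions below are invariant
-- under isomorphism, so this is only a choice of representatives.
record Structure (τ : Vocabulary) : Set₁ where
  field
    size     : ℕ
    nonEmpty : NonZero size
    rel      : (R : Fin (symbols τ)) → Pred (Vec (Fin size) (arity τ R)) 0ℓ

open Structure public

-- Members of a class may have different vocabularies.
StructureClass : (ℓ : Level) → Set (lsuc 0ℓ ⊔ˡ lsuc ℓ)
StructureClass ℓ = (τ : Vocabulary) → Pred (Structure τ) ℓ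

module _ {τ : Vocabulary} where

  IsHom : (A B : Structure τ) → (Fin (size A) → Fin (size B)) → Set
  IsHom A B f = ∀ R t → rel A R t → rel B R (Vec.map f t)

  Hom : (A B : Structure τ) → Set
  Hom A B = ∃ λ f → IsHom A B f

  IsCore : Structure τ → Set
  IsCore A = ∀ f → IsHom A A f → Injective _≡_ _≡_ f

  -- The containments B ⊆ A and R^B ⊆ R^A are expressed, up to renaming the
  -- elements of B, by an injective homomorphism from B to A.
  record _IsCoreOf_ (B A : Structure τ) : Set where
    field
      embed           : Fin (size B) → Fin (size A)
      embed-injective : Injective _≡_ _≡_ embed
      embed-hom       : IsHom B A embed
      retract         : Hom A B
      isCore          : IsCore B

------------------------------------------------------------------------
-- Games

-- The entry at a is nothing when a is outside the domain.
PartialMap : ℕ → ℕ → Set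
PartialMap n m = Vec (Maybe (Fin m)) n

dom : PartialMap n m → Subset n
dom = Vec.map is-just

_Extends_ : PartialMap n m → PartialMap n m → Set
g′ Extends g = ∀ a b → lookup g a ≡ just b → lookup g′ a ≡ just b

module _ {τ : Vocabulary} (A B : Structure τ) where

  -- The equation says that every entry of t lies in dom h and that u is the
  -- image of t under h. The empty map is a separate case because of nullary
  -- relation symbols.
  IsPartialHom : PartialMap (size A) (size B) → Set
  IsPartialHom h =
    dom h ≡ ⊥ ⊎
    (∀ R t u → rel A R t → Vec.map (lookup h) t ≡ Vec.map just u → rel B R u)

  -- A game vector with r + 1 rounds is an element of Vec ℕ (suc r).
  record WinningStrategy {r : ℕ} (v : Vec ℕ (suc r)) : Set₁ where
    field
      W          : Fin (suc r) → Pred (PartialMap (size A) (size B)) 0ℓ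
      partialHom : ∀ i h → W i h → IsPartialHom h
      first      : ∀ S → ∣ S ∣ ≤ lookup v zero →
                   ∃ λ h → W zero h × dom h ≡ S
      next       : ∀ (i : Fin r) g → W (inject₁ i) g →
                   ∀ S → dom g ⊆ S → ∣ S ─ dom g ∣ ≤ lookup v (suc i) →
                   ∃ λ g′ → W (suc i) g′ × g′ Extends g × dom g′ ≡ S

GameSolves : {r : ℕ} → Vec ℕ (suc r) → StructureClass ℓ → Set (lsuc 0ℓ ⊔ˡ ℓ)
GameSolves v 𝒜 = ∀ {τ} (A : Structure τ) → 𝒜 τ A →
                 ∀ (B : Structure τ) → WinningStrategy A B v → Hom A B

------------------------------------------------------------------------
-- Graphs

record SimpleGraph (V : Set) : Set₁ where
  field
    _~_      : Rel V 0ℓ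
    ~-sym    : Symmetric _~_
    ~-irrefl : Irreflexive _≡_ _~_

record Graph : Set₁ where
  field
    order    : ℕ
    nonEmpty : NonZero order
    graph    : SimpleGraph (Fin order)
  open SimpleGraph graph public

open Graph public using (order; graph)

GraphClass : (ℓ : Level) → Set (lsuc 0ℓ ⊔ˡ lsuc ℓ)
GraphClass ℓ = Pred Graph ℓ

induced : SimpleGraph (Fin n) → (S : Subset n) → SimpleGraph (∃ λ x → x ∈ S)
induced G S = record
  { _~_      = λ x y → proj₁ x ~ proj₁ y
  ; ~-sym    = ~-sym
  ; ~-irrefl = λ x≡y → ~-irrefl (cong proj₁ x≡y)
  }
  where open SimpleGraph G

Connected : {V : Set} → SimpleGraph V → Set
Connected G = ∀ x y → Star (SimpleGraph._~_ G) x y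

IsComponent : SimpleGraph (Fin n) → Subset n → Set
IsComponent G S =
  Nonempty S × Connected (induced G S) × (∀ {x y} → x ∈ S → x ~ y → y ∈ S)
  where open SimpleGraph G

gaifman : {τ : Vocabulary} → Structure τ → Graph
gaifman {τ} A = record
  { order    = size A
  ; nonEmpty = nonEmpty A
  ; graph    = record
    { _~_      = λ a a′ → a ≢ a′ × ∃₂ λ R t → rel A R t × a ∈ᵛ t × a′ ∈ᵛ t
    ; ~-sym    = λ (a≢a′ , R , t , Rt , a∈t , a′∈t) →
                   ≢-sym a≢a′ , R , t , Rt , a′∈t , a∈t
    ; ~-irrefl = λ a≡a′ (a≢a′ , _) → a≢a′ a≡a′
    }
  }
  where open VecMembership renaming (_∈_ to _∈ᵛ_)

-- The class of all graph(core(A)) with A in 𝒜, where core(A) ranges over all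
-- of its isomorphic copies.
data CoreGraphs (𝒜 : StructureClass ℓ) : GraphClass (lsuc 0ℓ ⊔ˡ ℓ) where
  coreGraph : ∀ {τ} {A B : Structure τ} →
              𝒜 τ A → B IsCoreOf A → CoreGraphs 𝒜 (gaifman B)

------------------------------------------------------------------------
-- Deconstructions

module _ (H G : Graph) where
  private
    module H = Graph H
    module G = Graph G

  record Deconstruction : Set where
    field
      bag : Fin H.order → Subset G.order

    location : Fin G.order → Subset H.order
    location g = tabulate λ h → lookup (bag h) g

    field
      covers    : ∀ g g′ → ReflClosure G._~_ g g′ →
                  ∃₂ λ h h′ → ReflClosure H._~_ h h′ ×
                              g ∈ bag h ∪ bag h′ × g′ ∈ bag h ∪ bag h′
      connected : ∀ g → Connected (induced H.graph (location g))

  Width≤ : Deconstruction → ℕ → Set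
  Width≤ D k = ∀ h h′ → ReflClosure H._~_ h h′ → ∣ bag h ∪ bag h′ ∣ ≤ k
    where open Deconstruction D

infix 4 _≼_
_≼_ : ∀ {ℓ₁ ℓ₂} → GraphClass ℓ₁ → GraphClass ℓ₂ → Set (lsuc 0ℓ ⊔ˡ ℓ₁ ⊔ˡ ℓ₂)
𝒢 ≼ ℋ = ∃ λ k → 1 ≤ k ×
        (∀ G → 𝒢 G → ∃ λ H → ℋ H × ∃ λ (D : Deconstruction H G) → Width≤ H G D k)

------------------------------------------------------------------------
-- Forests and tree depth

module _ {V : Set} (G : SimpleGraph V) where
  open SimpleGraph G

  -- A path with n edges; its vertices are pairwise distinct.
  record Path (n : ℕ) : Set where
    field
      vertex   : Fin (suc n) → V
      distinct : Injective _≡_ _≡_ vertex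
      step     : ∀ (i : Fin n) → vertex (inject₁ i) ~ vertex (suc i)

    start end : V
    start = vertex zero
    end   = vertex (fromℕ n)

  open Path

  -- A cycle is a path with at least two edges whose end is adjacent to its
  -- start.
  Acyclic : Set
  Acyclic = ∀ {n} (p : Path n) → 2 ≤ n → ¬ end p ~ start p

  IsTree : Set
  IsTree = Connected G × Acyclic

  RootedHeight≤ : V → ℕ → Set
  RootedHeight≤ root r = ∀ {n} (p : Path n) → start p ≡ root → n ≤ r

  TreeHeight≤ : ℕ → Set
  TreeHeight≤ r = ∃ λ root → RootedHeight≤ root r

  -- With respect to a root, u is an ancestor of w if it lies on the path from
  -- the root to w; every vertex is an ancestor of itself.
  Ancestor : V → V → V → Set
  Ancestor root u w =
    ∃₂ λ n (p : Path n) → start p ≡ root × end p ≡ w × ∃ λ i → vertex p i ≡ u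

ForestsOfHeight≤ : ℕ → GraphClass 0ℓ
ForestsOfHeight≤ r G =
  Acyclic (graph G) ×
  (∀ S → IsComponent (graph G) S → TreeHeight≤ (induced (graph G) S) r)

ConnectedTreeDepth≤ : {V : Set} → SimpleGraph V → ℕ → Set₁
ConnectedTreeDepth≤ {V} G h =
  ∃₂ λ (T : SimpleGraph V) (root : V) →
    IsTree T × RootedHeight≤ T root h ×
    (∀ u w → u ~ w → Ancestor T root u w ⊎ Ancestor T root w u)
  where open SimpleGraph G

TreeDepth≤ : Graph → ℕ → Set₁
TreeDepth≤ G d =
  ∀ S → IsComponent (graph G) S → ConnectedTreeDepth≤ (induced (graph G) S) d

BoundedTreeDepth : GraphClass ℓ → Set (lsuc 0ℓ ⊔ˡ ℓ)
BoundedTreeDepth 𝒢 = ∃ λ d → ∀ G → 𝒢 G → TreeDepth≤ G d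

------------------------------------------------------------------------
-- Minors and stack depth

-- M is a minor of G; branch w is the set of vertices contracted to w.
record _MinorOf_ {W : Set} (M : SimpleGraph W) (G : Graph) : Set where
  private
    module M = SimpleGraph M
    module G = Graph G
  field
    branch    : W → Subset G.order
    nonempty  : ∀ w → Nonempty (branch w)
    connected : ∀ w → Connected (induced G.graph (branch w))
    disjoint  : ∀ w w′ → w ≢ w′ → Empty (branch w ∩ branch w′)
    edge      : ∀ w w′ → w M.~ w′ →
                ∃₂ λ x y → x ∈ branch w × y ∈ branch w′ × x G.~ y

-- The tree T_{h,k}. The alphabet {1, …, k} is represented by Fin k.
completeTree : (h k : ℕ) → SimpleGraph (Vec≤ (Fin k) h)
completeTree h k = record
  { _~_      = λ s t → IsChild s t ⊎ IsChild t s
  ; ~-sym    = swap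
  ; ~-irrefl = λ { {s} refl (inj₁ c) → noLoop s c ; {s} refl (inj₂ c) → noLoop s c }
  }
  where
  IsChild : Vec≤ (Fin k) h → Vec≤ (Fin k) h → Set
  IsChild t s = ∃ λ i → toList s ≡ toList t ∷ʳ i

  noLoop : ∀ s → ¬ IsChild s s
  noLoop s (i , eq) = 1+n≢n (sym (trans (cong length eq)
    (trans (length-++-sucʳ (toList s) i _)
           (cong (suc ∘ length) (++-identityʳ (toList s))))))

-- The stack depth is the maximum of the h satisfying this predicate, and ∞ if
-- there are infinitely many.
InStackDepthSet : GraphClass ℓ → ℕ → Set (lsuc 0ℓ ⊔ˡ ℓ)
InStackDepthSet 𝒢 h =
  ∀ k → 1 ≤ k → ∃ λ G → 𝒢 G × completeTree h k MinorOf G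

-- Holds vacuously for the empty class.
StackDepth≤ : GraphClass ℓ → ℕ → Set (lsuc 0ℓ ⊔ˡ ℓ)
StackDepth≤ 𝒢 r = ∀ h → InStackDepthSet 𝒢 h → h ≤ r

{-# OPTIONS --safe #-}
module Submission where

-- All three conditions say that, for some k, the spoiler wins the following
-- elimination game of r + 1 rounds on every graph G in the class. In a round
-- the duplicator moves to a component of what is left of G, and the spoiler
-- deletes at most k of its vertices; she wins when nothing is left.
--
-- Solving homomorphism problems: if the spoiler wins on the core, then the
-- answers of a winning Duplicator to her moves in the various components fit
-- together to a homomorphism. If she loses, then Duplicator wins the v-game on
-- the core A and a twisted copy of it, in which the edges at each vertex carry
-- bits of even sum, but of odd sum at one vertex: he keeps the place where the
-- parity is wrong in a component where the spoiler cannot win. Since A is a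
-- core, a homomorphism would give a global choice of bits, whose total parity
-- is both even and odd.
--
-- Deconstructions: the spoiler walks down the tree, deleting one bag per round;
-- conversely the components arising in the game form a forest of height r.
--
-- Minors: a minor T_{h,k+1} with h > r defeats the spoiler, because k deleted
-- vertices always miss the subtree below some child of the current node.
-- Conversely, induct on the tree depth and delete the vertex on top: either the
-- spoiler fails in many of the remaining components, and the trees found there
-- are joined through the deleted vertex, or the few components where she fails
-- can be dealt with in a single move of bounded size.

open import Algebra.Bundles using (CommutativeRing)
open import Axiom.ExcludedMiddle using (ExcludedMiddle)
open import Data.Bool using (Bool; true; false; if_then_else_; _∧_; _xor_)
open import Data.Bool.Properties using (xor-∧-commutativeRing; ∧-zeroʳ; ∧-identityʳ; ∧-comm; xor-comm; xor-identityʳ; xor-same; xor-assoc)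
open import Data.Empty using () renaming (⊥ to Absurd)
open import Data.Fin using (Fin; zero; suc; toℕ; inject₁; fromℕ; fromℕ<; opposite; punchIn; punchOut; quotient; remainder; combine; finToFun; funToFin)
open import Data.Fin.Properties using (0≢1+n; suc-injective; inject₁-injective; opposite-involutive; toℕ-fromℕ<; toℕ-fromℕ; punchIn-injective; punchInᵢ≢i; punchOut-injective; punchIn-punchOut; injective⇒≤; nonZeroIndex; pigeonhole; remQuot-combine; finToFun-funToFin) renaming (_≟_ to _≟ᶠ_)
open import Data.Fin.Relation.Unary.Top using (view; ‵fromℕ; ‵inject₁)
open import Data.Fin.Subset using (Subset; _∈_; _∉_; _⊆_; _∪_; _─_; _-_; ∣_∣; ⊤; ⊥; ⁅_⁆; inside; outside)
open import Data.Fin.Subset.Properties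
open import Data.List using (List; []; _∷_; _++_; _∷ʳ_; length; take; initLast; _∷ʳ′_)
open import Data.List.Properties using (∷-injective; ∷-injectiveˡ; ∷-injectiveʳ; ∷ʳ-injective; length-++; ++-assoc; ++-identityʳ; ++-conicalˡ; ++-cancelˡ; length-++-≤ˡ) renaming (≡-dec to List-≡-dec)
open import Data.Maybe using (Maybe; just; nothing; is-just; fromMaybe)
open import Data.Nat using (ℕ; zero; suc; pred; _+_; _*_; _^_; _⊔_; _≤_; _<_; _≤?_; z≤n; s≤s; NonZero)
open import Data.Nat.GeneralisedArithmetic using (fold; fold-+)
open import Data.Nat.Properties hiding (0≢1+n; suc-injective)
open import Data.Product using (∃; ∃₂; _×_; _,_; proj₁; proj₂)
open import Data.Sum using (_⊎_; inj₁; inj₂; [_,_]′; swap)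
open import Data.Unit using (tt) renaming (⊤ to Unit)
open import Data.Vec as Vec using (Vec; []; _∷_; here; there; lookup; tabulate; replicate)
open import Data.Vec.Bounded as Vec≤ using (Vec≤; toList; isBounded)
open import Data.Vec.Membership.Propositional using () renaming (_∈_ to _∈ᵛ_)
open import Data.Vec.Membership.Propositional.Properties using (∈-lookup)
open import Data.Vec.Properties using ([]=⇒lookup; lookup⇒[]=; lookup∘tabulate; lookup-map; map-replicate; tabulate-cong; tabulate∘lookup; map-id; map-∘; map-cong; lookup-replicate; length-toList; toList∘fromList) renaming (∷-injective to Vec-∷-injective)
open import Data.Vec.Properties.WithK using ([]=-irrelevant)
open import Data.Vec.Relation.Binary.Pointwise.Inductive as Pointwise using (Pointwise; []; _∷_)
open import Data.Vec.Relation.Unary.Any using (index)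
open import Data.Vec.Relation.Unary.Any.Properties using (lookup-index)
open import Function using (_∘_; id)
open import Function.Bundles using (_⇔_; mk⇔)
open import Function.Definitions using (Injective)
open import Level using (Level; 0ℓ; Lift; lift; lower) renaming (_⊔_ to _⊔ˡ_; suc to lsuc)
open import Relation.Binary.Construct.Closure.Reflexive using (ReflClosure; refl; [_])
open import Relation.Binary.Construct.Closure.ReflexiveTransitive using (Star; ε; _◅_; _◅◅_) renaming (reverse to star-reverse)
open import Relation.Binary.PropositionalEquality hiding ([_])
open import Relation.Nullary using (¬_; yes; no; does; contradiction; Dec)
open import Relation.Nullary.Decidable using (dec-true; dec-false; map′)
open import Relation.Unary using (Pred)
open import Defs

open import Algebra.Properties.CommutativeMonoid.Sum
  (CommutativeRing.+-commutativeMonoid xor-∧-commutativeRing)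
  using (sum; sum-cong-≗; ∑-distrib-+; sum-replicate-zero)

private
  variable
    ℓ : Level
    h k m n : ℕ

-- Cardinalities of finite subsets

x∈p─q⇒x∉q : ∀ {n x} (p q : Subset n) → x ∈ p ─ q → x ∉ q
x∈p─q⇒x∉q (_ ∷ _) (_ ∷ _) () here
x∈p─q⇒x∉q (_ ∷ p) (_ ∷ q) (there i) (there j) = x∈p─q⇒x∉q p q i j

∣p∪q∣≤∣p∣+∣q∣ : ∀ {n} (p q : Subset n) → ∣ p ∪ q ∣ ≤ ∣ p ∣ + ∣ q ∣
∣p∪q∣≤∣p∣+∣q∣ [] [] = z≤n
∣p∪q∣≤∣p∣+∣q∣ (outside ∷ p) (outside ∷ q) = ∣p∪q∣≤∣p∣+∣q∣ p q
∣p∪q∣≤∣p∣+∣q∣ (outside ∷ p) (inside ∷ q)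
  rewrite +-suc ∣ p ∣ ∣ q ∣ = s≤s (∣p∪q∣≤∣p∣+∣q∣ p q)
∣p∪q∣≤∣p∣+∣q∣ (inside ∷ p) (outside ∷ q) = s≤s (∣p∪q∣≤∣p∣+∣q∣ p q)
∣p∪q∣≤∣p∣+∣q∣ (inside ∷ p) (inside ∷ q)
  rewrite +-suc ∣ p ∣ ∣ q ∣ = s≤s (m≤n⇒m≤1+n (∣p∪q∣≤∣p∣+∣q∣ p q))

∣p∣≤1+∣p-x∣ : ∀ (p : Subset n) x → ∣ p ∣ ≤ suc ∣ p - x ∣
∣p∣≤1+∣p-x∣ p x = begin
  ∣ p ∣                  ≤⟨ p⊆q⇒∣p∣≤∣q∣ split ⟩
  ∣ ⁅ x ⁆ ∪ (p - x) ∣    ≤⟨ ∣p∪q∣≤∣p∣+∣q∣ ⁅ x ⁆ (p - x) ⟩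
  ∣ ⁅ x ⁆ ∣ + ∣ p - x ∣  ≡⟨ cong (_+ ∣ p - x ∣) (∣⁅x⁆∣≡1 x) ⟩
  suc ∣ p - x ∣          ∎
  where
  open ≤-Reasoning
  split : ∀ {y} → y ∈ p → y ∈ ⁅ x ⁆ ∪ (p - x)
  split {y} y∈p with y ≟ᶠ x
  ... | yes refl = x∈p∪q⁺ (inj₁ (x∈⁅x⁆ x))
  ... | no  y≢x  = x∈p∪q⁺ (inj₂ (x∈p∧x∉q⇒x∈p─q y∈p (x≢y⇒x∉⁅y⁆ y≢x)))

injection⇒≤∣p∣ : (f : Fin m → Fin n) → Injective _≡_ _≡_ f →
                 (p : Subset n) → (∀ i → f i ∈ p) → m ≤ ∣ p ∣
injection⇒≤∣p∣ {zero}  f f-inj p f∈p = z≤n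
injection⇒≤∣p∣ {suc m} f f-inj p f∈p = begin-strict
  m               ≤⟨ injection⇒≤∣p∣ (f ∘ suc) (suc-injective ∘ f-inj) (p - f zero) rest ⟩
  ∣ p - f zero ∣  <⟨ x∈p⇒∣p-x∣<∣p∣ (f∈p zero) ⟩
  ∣ p ∣           ∎
  where
  open ≤-Reasoning
  rest : ∀ i → f (suc i) ∈ p - f zero
  rest i = x∈p∧x∉q⇒x∈p─q (f∈p (suc i))
             (x≢y⇒x∉⁅y⁆ (λ eq → 0≢1+n (sym (f-inj eq))))

∣p∣≤1⇒≡ : ∀ {p : Subset n} {x y} → ∣ p ∣ ≤ 1 → x ∈ p → y ∈ p → x ≡ y
∣p∣≤1⇒≡ {p = p} {x} {y} p≤1 x∈p y∈p with x ≟ᶠ y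
... | yes eq = eq
... | no  ne = contradiction (≤-trans (injection⇒≤∣p∣ f f-injective p f∈p) p≤1) λ { (s≤s ()) }
  where
  f : Fin 2 → Fin _
  f zero    = x
  f (suc _) = y
  f-injective : ∀ {i j} → f i ≡ f j → i ≡ j
  f-injective {zero}     {zero}     _  = refl
  f-injective {zero}     {suc zero} eq = contradiction eq ne
  f-injective {suc zero} {zero}     eq = contradiction (sym eq) ne
  f-injective {suc zero} {suc zero} _  = refl
  f∈p : ∀ i → f i ∈ p
  f∈p zero    = x∈p
  f∈p (suc _) = y∈p

-- Removing a point of `p` and its image from `q` costs `q` at most one element and leaves the rest
-- covered. The bound `k` on the size of `p` makes the recursion structural.
image⇒∣q∣≤∣p∣ : (f : Fin m → Fin n) (p : Subset m) (q : Subset n) →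
                (∀ {y} → y ∈ q → ∃ λ x → x ∈ p × f x ≡ y) → ∣ q ∣ ≤ ∣ p ∣
image⇒∣q∣≤∣p∣ {m} {n} f p q = bound ∣ p ∣ p q ≤-refl
  where
  bound : ∀ k (p : Subset m) (q : Subset n) → ∣ p ∣ ≤ k →
          (∀ {y} → y ∈ q → ∃ λ x → x ∈ p × f x ≡ y) → ∣ q ∣ ≤ ∣ p ∣
  bound k p q p≤k img with nonempty? p
  ... | no empty = begin
          ∣ q ∣             ≡⟨ cong ∣_∣ (Empty-unique λ (y , y∈q) →
                                 let x , x∈p , _ = img y∈q in empty (x , x∈p)) ⟩
          ∣ ⊥ {n} ∣  ≡⟨ ∣⊥∣≡0 n ⟩
          0                 ≤⟨ z≤n ⟩
          ∣ p ∣             ∎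
    where open ≤-Reasoning
  bound zero    p q p≤k img | yes (x , x∈p) =
    contradiction (≤-trans (x∈p⇒∣p-x∣<∣p∣ x∈p) p≤k) λ ()
  bound (suc k) p q p≤k img | yes (x , x∈p) = begin
    ∣ q ∣              ≤⟨ ∣p∣≤1+∣p-x∣ q (f x) ⟩
    suc ∣ q - f x ∣    ≤⟨ s≤s (bound k (p - x) (q - f x)
                            (≤-pred (≤-trans (x∈p⇒∣p-x∣<∣p∣ x∈p) p≤k)) img′) ⟩
    suc ∣ p - x ∣      ≤⟨ x∈p⇒∣p-x∣<∣p∣ x∈p ⟩
    ∣ p ∣              ∎
    where
    open ≤-Reasoning
    img′ : ∀ {y} → y ∈ q - f x → ∃ λ x′ → x′ ∈ p - x × f x′ ≡ y
    img′ {y} y∈ with img (p─q⊆p q ⁅ f x ⁆ y∈)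
    ... | x′ , x′∈p , refl = x′ , x∈p∧x∉q⇒x∈p─q x′∈p (x≢y⇒x∉⁅y⁆ (λ { refl →
            x∈p─q⇒x∉q q ⁅ f x ⁆ y∈ (x∈⁅x⁆ (f x)) })) , refl

range⇒∣q∣≤ : (f : Fin m → Fin n) (q : Subset n) →
             (∀ {y} → y ∈ q → ∃ λ x → f x ≡ y) → ∣ q ∣ ≤ m
range⇒∣q∣≤ {m} f q img = subst (∣ q ∣ ≤_) (∣⊤∣≡n m)
  (image⇒∣q∣≤∣p∣ f ⊤ q λ y∈q → let x , eq = img y∈q in x , ∈⊤ , eq)

⋃ᶠ : (Fin m → Subset n) → Subset n
⋃ᶠ {zero}  X = ⊥
⋃ᶠ {suc m} X = X zero ∪ ⋃ᶠ (X ∘ suc)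

∈⋃ᶠ : ∀ (X : Fin m → Subset n) i {a} → a ∈ X i → a ∈ ⋃ᶠ X
∈⋃ᶠ X zero    a∈ = x∈p∪q⁺ (inj₁ a∈)
∈⋃ᶠ X (suc i) a∈ = x∈p∪q⁺ (inj₂ (∈⋃ᶠ (X ∘ suc) i a∈))

∣⋃ᶠ∣≤ : ∀ {k} (X : Fin m → Subset n) → (∀ i → ∣ X i ∣ ≤ k) → ∣ ⋃ᶠ X ∣ ≤ m * k
∣⋃ᶠ∣≤ {zero} {n} X X≤k = ≤-reflexive (∣⊥∣≡0 n)
∣⋃ᶠ∣≤ {suc m} X X≤k = ≤-trans (∣p∪q∣≤∣p∣+∣q∣ (X zero) (⋃ᶠ (X ∘ suc)))
  (+-mono-≤ (X≤k zero) (∣⋃ᶠ∣≤ (X ∘ suc) (X≤k ∘ suc)))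

-- Walks and paths

module _ {V : Set} (G : SimpleGraph V) where
  open SimpleGraph G

  -- Both ends lie in `S` as well. Partially applied, `Walk G S c` serves throughout as the
  -- predicate for the component of `c` in the subgraph induced on `S`.
  data Walk (S : Pred V 0ℓ) : V → V → Set where
    stay : ∀ {x} → S x → Walk S x x
    move : ∀ {x y z} → S x → x ~ y → Walk S y z → Walk S x z

module _ {V : Set} {G : SimpleGraph V} where
  open SimpleGraph G

  source∈ : ∀ {S x y} → Walk G S x y → S x
  source∈ (stay Sx)     = Sx
  source∈ (move Sx _ _) = Sx

  target∈ : ∀ {S x y} → Walk G S x y → S y
  target∈ (stay Sx)    = Sx
  target∈ (move _ _ w) = target∈ w

  walk-trans : ∀ {S x y z} → Walk G S x y → Walk G S y z → Walk G S x z
  walk-trans (stay _)      w′ = w′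
  walk-trans (move Sx e w) w′ = move Sx e (walk-trans w w′)

  walk-snoc : ∀ {S x y z} → Walk G S x y → y ~ z → S z → Walk G S x z
  walk-snoc w e Sz = walk-trans w (move (target∈ w) e (stay Sz))

  walk-sym : ∀ {S x y} → Walk G S x y → Walk G S y x
  walk-sym (stay Sx)     = stay Sx
  walk-sym (move Sx e w) = walk-snoc (walk-sym w) (~-sym e) Sx

  walk-mono : ∀ {S S′ : Pred V 0ℓ} → (∀ {a} → S a → S′ a) →
              ∀ {x y} → Walk G S x y → Walk G S′ x y
  walk-mono f (stay Sx)     = stay (f Sx)
  walk-mono f (move Sx e w) = move (f Sx) e (walk-mono f w)

  -- Every vertex of the walk is reached from `x` by an initial segment; thus a component is
  -- connected within itself.
  walk-within : ∀ {S x y} → Walk G S x y → Walk G (Walk G S x) x y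
  walk-within {S} {x} = go (stay ∘ source∈)
    where
    go : ∀ {u y} → (Walk G S u y → Walk G S x u) → Walk G S u y → Walk G (Walk G S x) u y
    go f w@(stay _)     = stay (f w)
    go f w@(move _ e v) = move (f w) e (go (λ v′ → walk-snoc (f w) e (source∈ v′)) v)

  -- A walk that meets `z` is cut just after its last visit there.
  last-exit : (∀ a b → a ≡ b ⊎ a ≢ b) → ∀ {S z x y} → Walk G S x y → y ≢ z →
              Walk G (λ a → S a × a ≢ z) x y ⊎
              (∃ λ u → z ~ u × Walk G (λ a → S a × a ≢ z) u y)
  last-exit dec (stay Sx) y≢z = inj₁ (stay (Sx , y≢z))
  last-exit dec {z = z} (move {x} Sx e w) y≢z with last-exit dec w y≢z
  ... | inj₂ r  = inj₂ r
  ... | inj₁ w′ with dec x z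
  ...   | inj₁ refl = inj₂ (_ , e , w′)
  ...   | inj₂ x≢z  = inj₁ (move (Sx , x≢z) e w′)

  exit : (∀ a b → a ≡ b ⊎ a ≢ b) → ∀ {S z y} → Walk G S z y → y ≢ z →
         ∃ λ u → z ~ u × Walk G (λ a → S a × a ≢ z) u y
  exit dec w y≢z with last-exit dec w y≢z
  ... | inj₂ r  = r
  ... | inj₁ w′ = contradiction refl (proj₂ (source∈ w′))

  open Path

  singleton : V → Path G 0
  singleton x = record
    { vertex   = λ _ → x
    ; distinct = λ { {zero} {zero} _ → refl }
    ; step     = λ ()
    }

  cons : ∀ {n} x (p : Path G n) → x ~ start p → (∀ i → x ≢ vertex p i) → Path G (suc n)
  cons x p e x∉p = record
    { vertex   = λ { zero → x ; (suc i) → vertex p i }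
    ; distinct = λ { {zero}  {zero}  _  → refl
                   ; {zero}  {suc j} eq → contradiction eq (x∉p j)
                   ; {suc i} {zero}  eq → contradiction (sym eq) (x∉p i)
                   ; {suc i} {suc j} eq → cong suc (distinct p eq) }
    ; step     = λ { zero → e ; (suc i) → step p i }
    }

  tail : ∀ {n} → Path G (suc n) → Path G n
  tail p = record
    { vertex   = vertex p ∘ suc
    ; distinct = suc-injective ∘ distinct p
    ; step     = step p ∘ suc
    }

  suffix : ∀ {n} (p : Path G n) i →
           ∃₂ λ m (q : Path G m) → start q ≡ vertex p i × end q ≡ end p ×
                                   (∀ j → ∃ λ l → vertex q j ≡ vertex p l)
  suffix {n}     p zero    = n , p , refl , refl , λ j → j , refl
  suffix {suc n} p (suc i) =
    let m , q , s , e , q⊆ = suffix (tail p) i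
    in  m , q , s , e , λ j → let l , eq = q⊆ j in suc l , eq

  opposite-fromℕ : ∀ n → opposite (fromℕ n) ≡ zero
  opposite-fromℕ zero    = refl
  opposite-fromℕ (suc n) = cong inject₁ (opposite-fromℕ n)

  opposite-inject₁ : ∀ {n} (i : Fin n) → opposite (inject₁ i) ≡ suc (opposite i)
  opposite-inject₁ zero    = refl
  opposite-inject₁ (suc i) = cong inject₁ (opposite-inject₁ i)

  reverse : ∀ {n} → Path G n → Path G n
  reverse p = record
    { vertex   = vertex p ∘ opposite
    ; distinct = λ {i} {j} eq → trans (sym (opposite-involutive i))
                   (trans (cong opposite (distinct p eq)) (opposite-involutive j))
    ; step     = λ i → subst (λ k → vertex p k ~ vertex p (opposite (suc i))) (sym (opposite-inject₁ i))
                   (~-sym (step p (opposite i)))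
    }

  end-reverse : ∀ {n} (p : Path G n) → end (reverse p) ≡ start p
  end-reverse {n} p = cong (vertex p) (opposite-fromℕ n)

  -- Loop erasure: if the new vertex already lies on the path built for the rest of the walk, only
  -- the suffix from that vertex is kept.
  walk⇒path : (∀ a b → a ≡ b ⊎ a ≢ b) → ∀ {S x y} → Walk G S x y →
              ∃₂ λ n (p : Path G n) → start p ≡ x × end p ≡ y × (∀ i → S (vertex p i))
  walk⇒path dec {x = x} (stay Sx) = 0 , singleton x , refl , refl , λ _ → Sx
  walk⇒path dec {S} {x} (move Sx e w) with walk⇒path dec w
  ... | n , p , refl , refl , p⊆S with search p
    where
    search : ∀ {n} (p : Path G n) → (∃ λ i → x ≡ vertex p i) ⊎ (∀ i → x ≢ vertex p i)
    search {n} p with dec x (vertex p zero)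
    ... | inj₁ eq = inj₁ (zero , eq)
    search {zero}  p | inj₂ ne = inj₂ λ { zero → ne }
    search {suc n} p | inj₂ ne with search (tail p)
    ... | inj₁ (i , eq) = inj₁ (suc i , eq)
    ... | inj₂ nes      = inj₂ λ { zero → ne ; (suc i) → nes i }
  ...   | inj₂ x∉p = suc n , cons x p e x∉p , refl , refl , λ { zero → Sx ; (suc i) → p⊆S i }
  ...   | inj₁ (i , x≡) with suffix p i
  ...     | m , q , s , t , q⊆ = m , q , trans s (sym x≡) , t ,
              λ j → let l , eq = q⊆ j in subst S (sym eq) (p⊆S l)

  path⇒walk : ∀ {S n} (p : Path G n) → (∀ i → S (vertex p i)) → Walk G S (start p) (end p)
  path⇒walk {n = zero}  p p⊆S = stay (p⊆S zero)
  path⇒walk {n = suc n} p p⊆S = move (p⊆S zero) (step p zero) (path⇒walk (tail p) (p⊆S ∘ suc))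

≡⊎≢ : (a b : Fin n) → a ≡ b ⊎ a ≢ b
≡⊎≢ a b with a ≟ᶠ b
... | yes eq = inj₁ eq
... | no  ne = inj₂ ne

-- The elimination game

Everything : {V : Set} → Pred V 0ℓ
Everything _ = Unit

module _ (G : SimpleGraph (Fin n)) where

  -- The spoiler's side of the game on the vertex set S: in a round with budget
  -- p she chooses at most p vertices X of the component to which the duplicator
  -- has moved; she wins when no vertex is left after the last round.
  Elim : Vec ℕ m → Pred (Fin n) 0ℓ → Set
  Elim []       S = ∀ a → ¬ S a
  Elim (p ∷ ps) S =
    ∀ c → S c → ∃ λ X → ∣ X ∣ ≤ p × Elim ps (λ a → Walk G S c a × a ∉ X)

replicate-mono : ∀ m {k l} → k ≤ l → Pointwise _≤_ (replicate m k) (replicate m l)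
replicate-mono zero    k≤l = []
replicate-mono (suc m) k≤l = k≤l ∷ replicate-mono m k≤l

module _ {G : SimpleGraph (Fin n)} where

  elim-mono : ∀ {ps qs : Vec ℕ m} → Pointwise _≤_ ps qs →
              ∀ {S S′ : Pred (Fin n) 0ℓ} → (∀ {a} → S′ a → S a) →
              Elim G ps S → Elim G qs S′
  elim-mono []         S′⊆S E a S′a = E a (S′⊆S S′a)
  elim-mono (p≤q ∷ ≤s) S′⊆S E c S′c with E c (S′⊆S S′c)
  ... | X , X≤p , EX = X , ≤-trans X≤p p≤q ,
        elim-mono ≤s (λ (w , a∉X) → walk-mono S′⊆S w , a∉X) EX

  elim-⊆ : ∀ {ps : Vec ℕ m} {S S′ : Pred (Fin n) 0ℓ} → (∀ {a} → S′ a → S a) →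
           Elim G ps S → Elim G ps S′
  elim-⊆ = elim-mono (Pointwise.refl ≤-refl)

  elim-budget : ∀ m {k l} {S : Pred (Fin n) 0ℓ} → k ≤ l →
                Elim G (replicate m k) S → Elim G (replicate m l) S
  elim-budget m k≤l = elim-mono (replicate-mono m k≤l) (λ Sa → Sa)

  elim-∅ : ∀ {ps : Vec ℕ m} {S : Pred (Fin n) 0ℓ} → (∀ a → ¬ S a) → Elim G ps S
  elim-∅ {ps = []}     S∅ = S∅
  elim-∅ {ps = p ∷ ps} S∅ c Sc = contradiction Sc (S∅ c)

  elim-rounds : ∀ {l m} {k} {S : Pred (Fin n) 0ℓ} → l ≤ m →
                Elim G (replicate l k) S → Elim G (replicate m k) S
  elim-rounds z≤n       E = elim-∅ E
  elim-rounds (s≤s l≤m) E c Sc = let X , X≤k , EX = E c Sc in X , X≤k , elim-rounds l≤m EX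

  -- The duplicator's first move commits him to one component, and all later play stays inside it.
  elim-componentwise : ∀ {ps : Vec ℕ m} {S : Pred (Fin n) 0ℓ} →
                       (∀ c → S c → Elim G ps (Walk G S c)) → Elim G ps S
  elim-componentwise {ps = []}     E a Sa = E a Sa a (stay Sa)
  elim-componentwise {ps = p ∷ ps} E c Sc with E c Sc c (stay Sc)
  ... | X , X≤p , EX = X , X≤p , elim-⊆ (λ (w , a∉X) → walk-within w , a∉X) EX

  -- The vertices of `X` are deleted one per round, whatever the duplicator does meanwhile; rounds
  -- left over when `X` is used up do no harm.
  elim-spread : ∀ {M} j (X : Subset n) {S : Pred (Fin n) 0ℓ} → ∣ X ∣ ≤ j →
                Elim G (replicate M 1) (λ a → S a × a ∉ X) →
                Elim G (replicate (j + M) 1) S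
  elim-spread {M} j X {S} X≤j E with nonempty? X
  ... | no empty = elim-rounds (m≤n+m M j) (elim-⊆ (λ {a} Sa → Sa , λ a∈X → empty (a , a∈X)) E)
  elim-spread zero X X≤j E | yes (x , x∈X) =
    contradiction (≤-trans (x∈p⇒∣p-x∣<∣p∣ x∈X) X≤j) λ ()
  elim-spread {M} (suc j) X {S} X≤j E | yes (x , x∈X) = λ c Sc →
    ⁅ x ⁆ , ≤-reflexive (∣⁅x⁆∣≡1 x) ,
    elim-spread j (X - x) (≤-pred (≤-trans (x∈p⇒∣p-x∣<∣p∣ x∈X) X≤j))
      (elim-⊆ (λ ((w , a∉x) , a∉X-x) → target∈ w , λ a∈X → a∉X-x (x∈p∧x∉q⇒x∈p─q a∈X a∉x)) E)

  -- Each large move is spread over `k` rounds. Play with single vertices is what corresponds to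
  -- tree depth.
  elim-singly : ∀ k m {S : Pred (Fin n) 0ℓ} →
                Elim G (replicate m k) S → Elim G (replicate (m * k) 1) S
  elim-singly k zero    E = E
  elim-singly k (suc m) {S} E = elim-componentwise λ c Sc →
    let X , X≤k , EX = E c Sc in elim-spread k X X≤k (elim-singly k m EX)

-- From trees to elimination

-- Vertices of G are located at vertices of T, so that every vertex of G has a
-- connected set of locations and adjacent vertices have equal or adjacent
-- locations. If all paths in T from z are short, the spoiler wins by choosing
-- everything located at z and following the duplicator to a component of T
-- without z.
module Locate
  {V : Set} (T : SimpleGraph V) (_≟_ : ∀ (a b : V) → a ≡ b ⊎ a ≢ b)
  (G : SimpleGraph (Fin n)) (D : Pred (Fin n) 0ℓ)
  (L : Fin n → V → Set)
  (located : ∀ g → D g → ∃ (L g))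
  (L-connected : ∀ {g y y′} → L g y → L g y′ → Walk T (L g) y y′)
  (L-edge : ∀ {g g′} → D g → D g′ → SimpleGraph._~_ G g g′ →
            ∃₂ λ y y′ → L g y × L g′ y′ × (y ≡ y′ ⊎ SimpleGraph._~_ T y y′))
  {k : ℕ} (bag : V → Subset n) (bag≤k : ∀ z → ∣ bag z ∣ ≤ k)
  (L⇒bag : ∀ {g z} → L g z → g ∈ bag z)
  where

  open Path
  private
    module T = SimpleGraph T

  -- A walk in `G` lifts to `T`: within the connected location set of each vertex, then across by
  -- `L-edge`.
  walk-locations : ∀ {C : Pred (Fin n) 0ℓ} {Z : Pred V 0ℓ} →
                   (∀ {g} → C g → D g) → (∀ {g y} → C g → L g y → Z y) →
                   ∀ {g g′} → Walk G C g g′ → ∀ {y y′} → L g y → L g′ y′ → Walk T Z y y′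
  walk-locations C⊆D C⊆Z (stay Cg) Ly Ly′ = walk-mono (C⊆Z Cg) (L-connected Ly Ly′)
  walk-locations C⊆D C⊆Z (move Cg e w) Ly Ly′
    with L-edge (C⊆D Cg) (C⊆D (source∈ w)) e
  ... | u , u′ , Lu , Lu′ , eq⊎e =
    walk-trans (walk-mono (C⊆Z Cg) (L-connected Ly Lu))
      (join eq⊎e (walk-locations C⊆D C⊆Z w Lu′ Ly′))
    where
    join : ∀ {v} → u ≡ u′ ⊎ u T.~ u′ → Walk T _ u′ v → Walk T _ u v
    join (inj₁ refl) v = v
    join (inj₂ e)    v = move (C⊆Z Cg Lu) e v

  -- Induction on the height, with `Z` containing all locations of `C`. After the move each
  -- remaining component is located beyond one neighbour `u` of `z`, and a path from `u` avoiding
  -- `z` can be prolonged by `z`, so the height drops by one.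
  elim-located : ∀ h (C : Pred (Fin n) 0ℓ) (Z : Pred V 0ℓ) z → Z z →
                 (∀ {y} → Z y → Walk T Z z y) →
                 (∀ {l} (p : Path T l) → start p ≡ z → (∀ i → Z (vertex p i)) → l ≤ h) →
                 (∀ {g} → C g → D g) → (∀ {g y} → C g → L g y → Z y) →
                 Elim G (replicate (suc h) k) C
  elim-located h C Z z Zz Z-conn short C⊆D C⊆Z c Cc = bag z , bag≤k z , rest h short
    where
    C′ : Pred (Fin n) 0ℓ
    C′ a = Walk G C c a × a ∉ bag z

    C′⊆Z-z : ∀ {g y} → C′ g → L g y → Z y × y ≢ z
    C′⊆Z-z (w , g∉) Ly = C⊆Z (target∈ w) Ly , λ { refl → g∉ (L⇒bag Ly) }

    next : ∀ {g} → C′ g → ∃₂ λ y u → L g y × z T.~ u × Walk T (λ a → Z a × a ≢ z) u y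
    next {g} C′g@(w , _) with located g (C⊆D (target∈ w))
    ... | y , Ly with exit _≟_ (Z-conn (C⊆Z (target∈ w) Ly)) (proj₂ (C′⊆Z-z C′g Ly))
    ...   | u , e , v = y , u , Ly , e , v

    rest : ∀ h → (∀ {l} (p : Path T l) → start p ≡ z → (∀ i → Z (vertex p i)) → l ≤ h) →
           Elim G (replicate h k) C′
    -- With no height left, a remaining vertex would yield an edge out of `z`, a path of length one.
    rest zero short g C′g with next C′g
    ... | y , u , Ly , e , v = contradiction
      (short (cons z (singleton u) e λ _ → ≢-sym (proj₂ (source∈ v))) refl
             λ { zero → Zz ; (suc _) → proj₁ (source∈ v) })
      λ ()
    rest (suc h) short = elim-componentwise {G = G} {ps = replicate (suc h) k} λ g C′g →
      let y , u , Ly , e , v = next C′g in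
      elim-located h (Walk G C′ g) (Walk T (λ a → Z a × a ≢ z) u) u
        (stay (source∈ v)) walk-within
        (λ p s p⊆ → ≤-pred (short
               (cons z p (subst (z T.~_) (sym s) e) λ i → ≢-sym (proj₂ (target∈ (p⊆ i)))) refl
               λ { zero → Zz ; (suc i) → proj₁ (target∈ (p⊆ i)) }))
        (λ w → C⊆D (target∈ (proj₁ (target∈ w))))
        (λ w Ly′ → walk-trans v (walk-locations
           (λ (w , _) → C⊆D (target∈ w)) C′⊆Z-z w Ly Ly′))

member≡ : {S : Subset n} {x y : ∃ λ a → a ∈ S} → proj₁ x ≡ proj₁ y → x ≡ y
member≡ {x = a , a∈} {y = .a , a∈′} refl = cong (a ,_) ([]=-irrelevant a∈ a∈′)

module _ (bag : Fin m → Subset n) {g : Fin n} {h : Fin m} where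

  ∈location⁺ : g ∈ bag h → h ∈ tabulate (λ h → lookup (bag h) g)
  ∈location⁺ g∈ = lookup⇒[]= h _ (trans (lookup∘tabulate _ h) ([]=⇒lookup g∈))

  ∈location⁻ : h ∈ tabulate (λ h → lookup (bag h) g) → g ∈ bag h
  ∈location⁻ h∈ = lookup⇒[]= g (bag h)
    (trans (sym (lookup∘tabulate (λ h → lookup (bag h) g) h)) ([]=⇒lookup h∈))

member-≡⊎≢ : {S : Subset n} (x y : ∃ λ a → a ∈ S) → x ≡ y ⊎ x ≢ y
member-≡⊎≢ (a , _) (b , _) with ≡⊎≢ a b
... | inj₁ a≡b = inj₁ (member≡ a≡b)
... | inj₂ a≢b = inj₂ (a≢b ∘ cong proj₁)

module _ {G : SimpleGraph (Fin n)} {S : Subset n} where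

  walk⇒star : ∀ {x y} → Walk G (_∈ S) x y → (x∈S : x ∈ S) (y∈S : y ∈ S) →
              Star (SimpleGraph._~_ (induced G S)) (x , x∈S) (y , y∈S)
  walk⇒star (stay _)     x∈S y∈S rewrite []=-irrelevant x∈S y∈S = ε
  walk⇒star (move _ e w) x∈S y∈S = e ◅ walk⇒star w (source∈ w) y∈S

  induced-star⇒walk : ∀ {x y} → Star (SimpleGraph._~_ (induced G S)) x y →
                      Walk G (_∈ S) (proj₁ x) (proj₁ y)
  induced-star⇒walk {x} ε        = stay (proj₂ x)
  induced-star⇒walk {x} (e ◅ es) = move (proj₂ x) e (induced-star⇒walk es)

module _ {V : Set} {G : SimpleGraph V} where
  open SimpleGraph G
  open Path

  star⇒walk : ∀ {x y} → Star _~_ x y → Walk G Everything x y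
  star⇒walk ε        = stay tt
  star⇒walk (e ◅ es) = move tt e (star⇒walk es)

  init : Path G (suc n) → Path G n
  init p = record
    { vertex   = vertex p ∘ inject₁
    ; distinct = λ eq → inject₁-injective (distinct p eq)
    ; step     = step p ∘ inject₁
    }

  -- The recursion removes the last vertex of `p`, because the initial segments of `p` are what
  -- witnesses that its vertices descend from `vertex p i`.
  walk-from-ancestor : ∀ {root n} (p : Path G n) → start p ≡ root → ∀ i →
                       Walk G (Ancestor G root (vertex p i)) (vertex p i) (end p)
  walk-from-ancestor {root} {n} p s i with view i
  walk-from-ancestor {root} {zero}  p s _ | ‵fromℕ = stay (0 , p , s , refl , zero , refl)
  walk-from-ancestor {root} {suc n} p s _ | ‵fromℕ = stay (suc n , p , s , refl , fromℕ (suc n) , refl)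
  walk-from-ancestor {root} {suc n} p s _ | ‵inject₁ i =
    walk-snoc (walk-from-ancestor (init p) s i) (step p (fromℕ n))
      (suc n , p , s , refl , inject₁ i , refl)

  module _ (dec : ∀ (a b : V) → a ≡ b ⊎ a ≢ b) (acyclic : Acyclic G) where

    -- Otherwise a path from `u` to `v` inside `S` would close up through `x`, which lies outside
    -- `S`, to a cycle.
    unique-neighbour : ∀ {S x u v} → ¬ S x → x ~ u → x ~ v → Walk G S u v → u ≡ v
    unique-neighbour {S} {x} {u} {v} ¬Sx x~u x~v w with dec u v
    ... | inj₁ eq = eq
    ... | inj₂ u≢v with walk⇒path dec w
    ...   | zero  , p , s , e , p⊆S = contradiction (trans (sym s) e) u≢v
    ...   | suc n , p , s , e , p⊆S = contradiction
              (subst (_~ x) (sym e) (~-sym x~v))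
              (acyclic (cons x p (subst (x ~_) (sym s) x~u)
                         λ i x≡ → ¬Sx (subst S (sym x≡) (p⊆S i))) (s≤s (s≤s z≤n)))

    -- Following one path to the common end and the other one back avoids the common start, so the
    -- second vertices agree by `unique-neighbour`; then induction on the tails.
    path-unique : ∀ {m n} (p : Path G m) (q : Path G n) → start p ≡ start q → end p ≡ end q →
                  ∀ i → ∃ λ j → vertex p j ≡ vertex q i
    path-unique p q s e zero = zero , s
    path-unique {zero} {suc n} p q s e (suc i) =
      contradiction (distinct q (trans (sym s) e)) λ ()
    path-unique {suc m} {suc n} p q s e (suc i) =
      let j , eq = path-unique (tail p) (tail q) next e i in suc j , eq
      where
      avoid : ∀ {n} (q : Path G (suc n)) → start p ≡ start q → ∀ i → vertex q (suc i) ≢ start p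
      avoid q s i eq = contradiction (distinct q (trans eq s)) λ ()
      next : vertex p (suc zero) ≡ vertex q (suc zero)
      next = unique-neighbour (λ ne → ne refl) (step p zero)
        (subst (_~ vertex q (suc zero)) (sym s) (step q zero))
        (walk-trans (path⇒walk (tail p) (avoid p refl))
          (subst (λ y → Walk G (_≢ start p) y (vertex q (suc zero))) (sym e)
            (walk-sym (path⇒walk (tail q) (avoid q s)))))

vec-ext : ∀ {A : Set} {xs ys : Vec A n} → (∀ i → lookup xs i ≡ lookup ys i) → xs ≡ ys
vec-ext {xs = xs} {ys} eq = trans (sym (tabulate∘lookup xs)) (trans (tabulate-cong eq) (tabulate∘lookup ys))

-- Partial maps

∈dom⁺ : (g : PartialMap n m) → ∀ {a b} → lookup g a ≡ just b → a ∈ dom g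
∈dom⁺ g {a} eq = lookup⇒[]= a (dom g) (trans (lookup-map a is-just g) (cong is-just eq))

∈dom⁻ : (g : PartialMap n m) → ∀ {a} → a ∈ dom g → ∃ λ b → lookup g a ≡ just b
∈dom⁻ g {a} a∈ with lookup g a | trans (sym (lookup-map a is-just g)) ([]=⇒lookup a∈)
... | just b | _ = b , refl

∅ : PartialMap n m
∅ = replicate _ nothing

dom-∅ : dom (∅ {n} {m}) ≡ ⊥
dom-∅ = map-replicate is-just nothing _

restrict : Subset n → (Fin n → Maybe (Fin m)) → PartialMap n m
restrict S f = tabulate λ a → if lookup S a then f a else nothing

lookup-restrict : ∀ (S : Subset n) (f : Fin n → Maybe (Fin m)) {a} → a ∈ S →
                  lookup (restrict S f) a ≡ f a
lookup-restrict S f {a} a∈S = trans (lookup∘tabulate _ a)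
  (cong (if_then f a else nothing) ([]=⇒lookup a∈S))

dom-restrict : ∀ (S : Subset n) (f : Fin n → Maybe (Fin m)) →
               (∀ {a} → a ∈ S → ∃ λ b → f a ≡ just b) → dom (restrict S f) ≡ S
dom-restrict S f total = vec-ext λ a → trans (lookup-map a is-just (restrict S f))
  (trans (cong is-just (lookup∘tabulate _ a)) (entry a (lookup S a) refl))
  where
  entry : ∀ a s → lookup S a ≡ s → is-just (if s then f a else nothing) ≡ s
  entry a false eq = refl
  entry a true  eq = cong is-just (proj₂ (total (lookup⇒[]= a S eq)))

-- The game, as a recursive predicate on positions

module _ {τ : Vocabulary} (A B : Structure τ) where

  -- The empty map is the position before the first round, which thereby takes the same form as the
  -- later rounds.
  DuplicatorWins : Vec ℕ m → PartialMap (size A) (size B) → Set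
  DuplicatorWins []       g = IsPartialHom A B g
  DuplicatorWins (p ∷ ps) g =
    IsPartialHom A B g ×
    (∀ S → dom g ⊆ S → ∣ S ─ dom g ∣ ≤ p →
     ∃ λ g′ → DuplicatorWins ps g′ × g′ Extends g × dom g′ ≡ S)

  wins⇒partialHom : ∀ (ps : Vec ℕ m) {g} → DuplicatorWins ps g → IsPartialHom A B g
  wins⇒partialHom []       win = win
  wins⇒partialHom (p ∷ ps) win = proj₁ win

  strategy⇒wins : ∀ {r} (v : Vec ℕ (suc r)) → WinningStrategy A B v → DuplicatorWins v ∅
  strategy⇒wins {r} (p ∷ ps) strategy = inj₁ dom-∅ , λ S _ S≤p →
    let g , Wg , dom≡S = first S (subst (λ D → ∣ D ∣ ≤ p) (trans (cong (S ─_) dom-∅) (p─⊥≡p S)) S≤p)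
    in g , later ps W partialHom next g Wg , (λ a b eq → contradiction (trans (sym (lookup-replicate a nothing)) eq) λ ()) , dom≡S
    where
    open WinningStrategy strategy
    later : ∀ {r} (ps : Vec ℕ r) (W : Fin (suc r) → Pred (PartialMap (size A) (size B)) 0ℓ) →
            (∀ i h → W i h → IsPartialHom A B h) →
            (∀ i g → W (inject₁ i) g → ∀ S → dom g ⊆ S → ∣ S ─ dom g ∣ ≤ lookup ps i →
             ∃ λ g′ → W (suc i) g′ × g′ Extends g × dom g′ ≡ S) →
            ∀ g → W zero g → DuplicatorWins ps g
    later []       W hom next g Wg = hom zero g Wg
    later (p ∷ ps) W hom next g Wg = hom zero g Wg , λ S D⊆S S≤p →
      let g′ , Wg′ , ext , eq = next zero g Wg S D⊆S S≤p
      in g′ , later ps (W ∘ suc) (hom ∘ suc) (next ∘ suc) g′ Wg′ , ext , eq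

  private
    -- The canonical strategy: each set consists of all positions from which Duplicator wins the
    -- rounds still to come.
    After : ∀ {r} → Vec ℕ r → Fin (suc r) → Pred (PartialMap (size A) (size B)) 0ℓ
    After ps       zero    = DuplicatorWins ps
    After (p ∷ ps) (suc i) = After ps i

    after-partialHom : ∀ {r} (ps : Vec ℕ r) i g → After ps i g → IsPartialHom A B g
    after-partialHom ps       zero    g win = wins⇒partialHom ps win
    after-partialHom (p ∷ ps) (suc i) g win = after-partialHom ps i g win

    after-next : ∀ {r} (ps : Vec ℕ r) i g → After ps (inject₁ i) g →
                 ∀ S → dom g ⊆ S → ∣ S ─ dom g ∣ ≤ lookup ps i →
                 ∃ λ g′ → After ps (suc i) g′ × g′ Extends g × dom g′ ≡ S
    after-next (p ∷ ps) zero    g (_ , win) = win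
    after-next (p ∷ ps) (suc i) g win       = after-next ps i g win

  wins⇒strategy : ∀ {r} (v : Vec ℕ (suc r)) → DuplicatorWins v ∅ → WinningStrategy A B v
  wins⇒strategy (p ∷ ps) (_ , win) = record
    { W          = After ps
    ; partialHom = after-partialHom ps
    ; first      = λ S S≤p →
        let g , wg , _ , eq = win S (λ {x} x∈ → contradiction (subst (x ∈_) dom-∅ x∈) ∉⊥)
                                (≤-trans (∣p─q∣≤∣p∣ S (dom ∅)) S≤p)
        in g , wg , eq
    ; next       = after-next ps
    }

element : NonZero n → Fin n
element {suc n} _ = zero

Fin? : ∀ n → Fin n ⊎ ¬ Fin n
Fin? zero    = inj₂ λ ()
Fin? (suc n) = inj₁ zero

-- Parities

δ : Fin n → Fin n → Bool
δ a b = does (a ≟ᶠ b)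

δ-≢ : {a b : Fin n} → a ≢ b → δ a b ≡ false
δ-≢ {a = a} {b} = dec-false (a ≟ᶠ b)

sum-δ : (f : Fin n → Bool) (w : Fin n) → sum (λ b → δ w b ∧ f b) ≡ f w
sum-δ {suc n} f zero    = trans (cong (f zero xor_) (sum-replicate-zero n)) (xor-identityʳ (f zero))
sum-δ {suc n} f (suc w) = sum-δ (f ∘ suc) w

-- Handshaking: the entries above and below the diagonal cancel modulo two. First row and first
-- column are split off together.
sum-symmetric : (M : Fin n → Fin n → Bool) → (∀ a b → M a b ≡ M b a) → (∀ a → M a a ≡ false) →
                sum (λ a → sum (M a)) ≡ false
sum-symmetric {zero}  M sym′ diag = refl
sum-symmetric {suc n} M sym′ diag = begin
  (M zero zero xor row) xor sum (λ a → M (suc a) zero xor sum (M (suc a) ∘ suc))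
    ≡⟨ cong₂ (λ d s → (d xor row) xor s) (diag zero)
         (∑-distrib-+ (λ a → M (suc a) zero) (λ a → sum (M (suc a) ∘ suc))) ⟩
  row xor (sum (λ a → M (suc a) zero) xor sum (λ a → sum (M (suc a) ∘ suc)))
    ≡⟨ cong₂ (λ c s → row xor (c xor s)) (sum-cong-≗ λ a → sym′ (suc a) zero)
         (sum-symmetric (λ a b → M (suc a) (suc b)) (λ a b → sym′ (suc a) (suc b)) (diag ∘ suc)) ⟩
  row xor (row xor false)
    ≡⟨ cong (row xor_) (xor-identityʳ row) ⟩
  row xor row
    ≡⟨ xor-same row ⟩
  false ∎
  where
  open ≡-Reasoning
  row = sum (λ b → M zero (suc b))

private
  -- One summand of a row sum after an edge has been flipped, arranged so that `sum-δ` can evaluate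
  -- the two new terms.
  distribute-flip : ∀ A x p q r s → A ∧ (x xor ((p ∧ q) xor (r ∧ s))) ≡
                                    (A ∧ x) xor ((q ∧ (p ∧ A)) xor (s ∧ (r ∧ A)))
  distribute-flip false x p q r s rewrite ∧-zeroʳ p | ∧-zeroʳ q | ∧-zeroʳ r | ∧-zeroʳ s = refl
  distribute-flip true  x p q r s rewrite ∧-identityʳ p | ∧-identityʳ r | ∧-comm q p | ∧-comm s r = refl

  cancel-middle : ∀ p q s → (p xor q) xor (q xor s) ≡ p xor s
  cancel-middle p q s = begin
    (p xor q) xor (q xor s)  ≡⟨ xor-assoc p q (q xor s) ⟩
    p xor (q xor (q xor s))  ≡⟨ cong (p xor_) (xor-assoc q q s) ⟨
    p xor ((q xor q) xor s)  ≡⟨ cong (λ z → p xor (z xor s)) (xor-same q) ⟩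
    p xor s                  ∎
    where open ≡-Reasoning

fold-injective : {A : Set} (f : A → A) → Injective _≡_ _≡_ f → ∀ i → Injective _≡_ _≡_ (λ x → fold x f i)
fold-injective f inj zero    eq = eq
fold-injective f inj (suc i) eq = fold-injective f inj i (inj eq)

-- Among `suc (n ^ n)` iterates two agree as maps, and injectivity cancels the earlier one. The
-- period is common to all points.
injective⇒periodic : (f : Fin n → Fin n) → Injective _≡_ _≡_ f → ∃ λ d → ∀ x → fold x f (suc d) ≡ x
injective⇒periodic {n} f inj
  with pigeonhole ≤-refl (λ (i : Fin (suc (n ^ n))) → funToFin (λ x → fold x f (toℕ i)))
... | i , j , i<j , same with m≤n⇒∃[o]m+o≡n i<j
...   | d , i+d≡j = d , λ x → fold-injective f inj (toℕ i) (begin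
    fold (fold x f (suc d)) f (toℕ i)                ≡⟨ fold-+ x f (toℕ i) ⟨
    fold x f (toℕ i + suc d)                            ≡⟨ cong (fold x f) (trans (+-suc (toℕ i) d) i+d≡j) ⟩
    fold x f (toℕ j)                                    ≡⟨ finToFun-funToFin (λ y → fold y f (toℕ j)) x ⟨
    finToFun {n} {n} (funToFin (λ y → fold y f (toℕ j))) x      ≡⟨ cong (λ k → finToFun {n} {n} k x) same ⟨
    finToFun {n} {n} (funToFin (λ y → fold y f (toℕ i))) x      ≡⟨ finToFun-funToFin (λ y → fold y f (toℕ i)) x ⟩
    fold x f (toℕ i)                                    ∎)
  where open ≡-Reasoning

hom-∘ : ∀ {τ} {A B C : Structure τ} {f g} → IsHom B C g → IsHom A B f → IsHom A C (g ∘ f)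
hom-∘ {C = C} {f} {g} g-hom f-hom R t Rt =
  subst (rel C R) (sym (map-∘ g f t)) (g-hom R _ (f-hom R t Rt))

fold-hom : ∀ {τ} {A : Structure τ} {f} → IsHom A A f → ∀ i → IsHom A A (λ x → fold x f i)
fold-hom {A = A} f-hom zero    R t Rt = subst (rel A R) (sym (map-id t)) Rt
fold-hom {A = A} f-hom (suc i) = hom-∘ {A = A} {A} {A} f-hom (fold-hom {A = A} f-hom i)

-- Prefixes

infix 4 _⊑_
_⊑_ : {A : Set} → List A → List A → Set
u ⊑ l = ∃ λ v → u ++ v ≡ l

module _ {A : Set} where

  ⊑-refl : {u : List A} → u ⊑ u
  ⊑-refl {u} = [] , ++-identityʳ u

  ⊑-trans : {u v w : List A} → u ⊑ v → v ⊑ w → u ⊑ w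
  ⊑-trans {u} (x , refl) (y , refl) = x ++ y , sym (++-assoc u x y)

  ⊑-∷ : ∀ (x : A) {u v} → u ⊑ v → x ∷ u ⊑ x ∷ v
  ⊑-∷ x (y , eq) = y , cong (x ∷_) eq

  ⊑-length : {u l : List A} → u ⊑ l → length u ≤ length l
  ⊑-length {u} (v , refl) = length-++-≤ˡ u

  ⊑⇒take : {u l : List A} → u ⊑ l → u ≡ take (length u) l
  ⊑⇒take {[]}    _          = refl
  ⊑⇒take {x ∷ u} (v , refl) = cong (x ∷_) (⊑⇒take {u} (v , refl))

  ⊑-unique : {u v l : List A} → u ⊑ l → v ⊑ l → length u ≡ length v → u ≡ v
  ⊑-unique {l = l} u⊑l v⊑l eq =
    trans (⊑⇒take u⊑l) (trans (cong (λ i → take i l) eq) (sym (⊑⇒take v⊑l)))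

  length-∷ʳ : ∀ (w : List A) x → length (w ∷ʳ x) ≡ suc (length w)
  length-∷ʳ w x = trans (length-++ w) (+-comm (length w) 1)

  ∷ʳ≢[] : ∀ (w : List A) {x} → w ∷ʳ x ≢ []
  ∷ʳ≢[] []      ()
  ∷ʳ≢[] (_ ∷ _) ()

  ⊑-∷ʳ : ∀ {u : List A} {w x} → u ⊑ w ∷ʳ x → u ≢ w ∷ʳ x → u ⊑ w
  ⊑-∷ʳ {u} {w} {x} (v , eq) u≢ with initLast v
  ... | []       = contradiction (trans (sym (++-identityʳ u)) eq) u≢
  ... | v′ ∷ʳ′ y = v′ , proj₁ (∷ʳ-injective (u ++ v′) w (trans (++-assoc u v′ (y ∷ [])) eq))

-- Forests given by a parent relation

module ParentRelation
  {V : Set} (T : SimpleGraph V) (Child : V → V → Set) (depth : V → ℕ)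
  (edge : ∀ {a b} → SimpleGraph._~_ T a b → Child a b ⊎ Child b a)
  (depth-child : ∀ {a b} → Child a b → depth b ≡ suc (depth a))
  (parent-unique : ∀ {a a′ b} → Child a b → Child a′ b → a ≡ a′)
  where
  open Path

  -- A step up right after a step down would return to the unique parent, the vertex just left; so a
  -- path that starts downwards keeps going down.
  descend : (p : Path T (suc n)) → Child (vertex p zero) (vertex p (suc zero)) →
            ∀ i → Child (vertex p (inject₁ i)) (vertex p (suc i))
  descend         p c zero    = c
  descend {suc n} p c (suc i) with edge (step p (suc zero))
  ... | inj₁ c′ = descend (tail p) c′ i
  ... | inj₂ c′ = contradiction (distinct p (parent-unique c c′)) λ ()

  depth-along : (p : Path T n) → (∀ i → Child (vertex p (inject₁ i)) (vertex p (suc i))) →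
                ∀ i → depth (vertex p i) ≡ toℕ i + depth (start p)
  depth-along p down zero = refl
  depth-along {suc n} p down (suc i) = begin
    depth (vertex p (suc i))                            ≡⟨ depth-along (tail p) (down ∘ suc) i ⟩
    toℕ i + depth (vertex p (suc zero))                 ≡⟨ cong (toℕ i +_) (depth-child (down zero)) ⟩
    toℕ i + suc (depth (start p))                       ≡⟨ +-suc (toℕ i) _ ⟩
    suc (toℕ i) + depth (start p)                       ∎
    where open ≡-Reasoning

  depth-end : (p : Path T n) → (∀ i → Child (vertex p (inject₁ i)) (vertex p (suc i))) →
              depth (end p) ≡ n + depth (start p)
  depth-end {n} p down = trans (depth-along p down (fromℕ n)) (cong (_+ depth (start p)) (toℕ-fromℕ n))

  -- A path from a vertex below its end would have to go down at every step.
  end-not-parent : (p : Path T n) → 2 ≤ n → ¬ Child (end p) (start p)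
  end-not-parent {suc (suc n)} p (s≤s (s≤s _)) c with edge (step p zero)
  ... | inj₂ c′ = contradiction (distinct p (parent-unique c c′)) λ ()
  ... | inj₁ c′ = m≢1+n+m (depth (start p)) {suc (suc n)}
    (trans (depth-child c) (cong suc (depth-end p (descend p c′))))

  acyclic : Acyclic T
  acyclic p n≥2 e with edge e
  ... | inj₁ c = end-not-parent p n≥2 c
  ... | inj₂ c = end-not-parent (reverse p) n≥2 (subst (λ x → Child x (end p)) (sym (end-reverse p)) c)

  descend-from-root : (p : Path T n) → (∀ y → ¬ Child y (start p)) →
                      ∀ i → Child (vertex p (inject₁ i)) (vertex p (suc i))
  descend-from-root {suc n} p no-parent with edge (step p zero)
  ... | inj₁ c = descend p c
  ... | inj₂ c = contradiction c (no-parent _)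

  rooted-height : ∀ {z D} → (∀ y → ¬ Child y z) → (∀ y → depth y ≤ D) →
                  ∀ {n} (p : Path T n) → start p ≡ z → n + depth z ≤ D
  rooted-height no-parent depth≤ p refl =
    subst (_≤ _) (depth-end p (descend-from-root p no-parent)) (depth≤ (end p))

-- A minor model of T_{h,k} inside C whose root branch contains x. Words longer
-- than h are irrelevant.
record TreeModel (G : SimpleGraph (Fin n)) (k h : ℕ) (C : Pred (Fin n) 0ℓ) (x : Fin n) : Set₁ where
  open SimpleGraph G
  field
    branch    : List (Fin k) → Pred (Fin n) 0ℓ
    root∈     : branch [] x
    within    : ∀ w → length w ≤ h → ∀ {a} → branch w a → C a
    nonempty  : ∀ w → length w ≤ h → ∃ (branch w)
    connected : ∀ w → length w ≤ h → ∀ {a b} → branch w a → branch w b → Walk G (branch w) a b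
    disjoint  : ∀ w w′ → length w ≤ h → length w′ ≤ h → ∀ {a} → branch w a → branch w′ a → w ≡ w′
    edge      : ∀ w i → length (w ∷ʳ i) ≤ h → ∃₂ λ a b → branch w a × branch (w ∷ʳ i) b × a ~ b

toList-injective : ∀ {A : Set} (xs ys : Vec≤ A h) → toList xs ≡ toList ys → xs ≡ ys
toList-injective {A = A} (xs Vec≤., _) (ys Vec≤., _) eq with same xs ys eq
  where
  same : ∀ {m n} (xs : Vec A m) (ys : Vec A n) → Vec.toList xs ≡ Vec.toList ys →
         _≡_ {A = ∃ (Vec A)} (m , xs) (n , ys)
  same Vec.[]       Vec.[]       _  = refl
  same (x Vec.∷ xs) (y Vec.∷ ys) eq with ∷-injective eq
  ... | refl , eq′ with same xs ys eq′
  ...   | refl = refl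
... | refl = refl

minor⇒model : (G : Graph) → completeTree h k MinorOf G → ∃ (TreeModel (graph G) k h Everything)
minor⇒model {h} {k} G M = proj₁ (M.nonempty (word [] z≤n)) , record
  { branch    = branch
  ; root∈     = z≤n , proj₂ (M.nonempty (word [] z≤n))
  ; within    = λ _ _ _ → tt
  ; nonempty  = λ w w≤h → let a , a∈ = M.nonempty (word w w≤h) in a , w≤h , a∈
  ; connected = λ { w w≤h (_ , a∈) (_ , b∈) →
      walk-mono (w≤h ,_) (induced-star⇒walk (M.connected (word w w≤h) (_ , a∈) (_ , b∈))) }
  ; disjoint  = disjoint
  ; edge      = λ w i wi≤h →
      let w≤h = ≤-trans (⊑-length {u = w} (i ∷ [] , refl)) wi≤h
          a , b , a∈ , b∈ , e = M.edge (word w w≤h) (word (w ∷ʳ i) wi≤h)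
            (inj₁ (i , trans (toList∘fromList (w ∷ʳ i)) (cong (_∷ʳ i) (sym (toList∘fromList w)))))
      in a , b , (w≤h , a∈) , (wi≤h , b∈) , e
  }
  where
  module M = _MinorOf_ M
  word : (w : List (Fin k)) → length w ≤ h → Vec≤ (Fin k) h
  word w w≤h = Vec.fromList w Vec≤., w≤h

  branch : List (Fin k) → Pred (Fin (Graph.order G)) 0ℓ
  branch w a = ∃ λ (w≤h : length w ≤ h) → a ∈ M.branch (word w w≤h)

  disjoint : ∀ w w′ → length w ≤ h → length w′ ≤ h → ∀ {a} → branch w a → branch w′ a → w ≡ w′
  disjoint w w′ _ _ {a} (w≤h , a∈) (w′≤h , a∈′) with List-≡-dec _≟ᶠ_ w w′
  ... | yes eq = eq
  ... | no  ne = contradiction (a , x∈p∩q⁺ (a∈ , a∈′)) (M.disjoint (word w w≤h) (word w′ w′≤h)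
          λ eq → ne (trans (sym (toList∘fromList w)) (trans (cong toList eq) (toList∘fromList w′))))

-- The condition to which all three statements are reduced. The budget is uniform over the class.
Eliminable : GraphClass ℓ → ℕ → Set (lsuc 0ℓ ⊔ˡ ℓ)
Eliminable 𝒢 r = ∃ λ k → 1 ≤ k × (∀ G → 𝒢 G → Elim (graph G) (replicate (suc r) k) Everything)

module Classical (em : ExcludedMiddle 0ℓ) where

  -- Excluded middle turns predicates into subsets, so that they can be counted and used as moves or
  -- bags.
  ⟦_⟧ : Pred (Fin n) 0ℓ → Subset n
  ⟦ P ⟧ = tabulate λ i → does (em {P i})

  ∈⟦⟧⁺ : ∀ {P : Pred (Fin n) 0ℓ} {i} → P i → i ∈ ⟦ P ⟧
  ∈⟦⟧⁺ {P = P} {i} Pi = lookup⇒[]= i ⟦ P ⟧ (trans (lookup∘tabulate _ i) (dec-true em Pi))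

  ∈⟦⟧⁻ : ∀ {P : Pred (Fin n) 0ℓ} {i} → i ∈ ⟦ P ⟧ → P i
  ∈⟦⟧⁻ {P = P} {i} i∈ with em {P i} | trans (sym (lookup∘tabulate (λ i → does (em {P i})) i)) ([]=⇒lookup i∈)
  ... | yes Pi | _ = Pi

  component : SimpleGraph (Fin n) → Fin n → Subset n
  component G c = ⟦ Walk G Everything c ⟧

  component-walk : ∀ {G : SimpleGraph (Fin n)} {c y} → Walk G Everything c y → Walk G (_∈ component G c) c y
  component-walk w = walk-mono ∈⟦⟧⁺ (walk-within w)

  component-isComponent : ∀ (G : SimpleGraph (Fin n)) c → IsComponent G (component G c)
  component-isComponent G c =
      (c , ∈⟦⟧⁺ (stay tt))
    , (λ (x , x∈) (y , y∈) → walk⇒star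
         (walk-trans (walk-sym (component-walk (∈⟦⟧⁻ x∈))) (component-walk (∈⟦⟧⁻ y∈))) x∈ y∈)
    , λ x∈ e → ∈⟦⟧⁺ (walk-snoc (∈⟦⟧⁻ x∈) e tt)

  -- Elimination from deconstructions and from tree depth

  deconstruction⇒elim : ∀ {r k} (H G : Graph) → ForestsOfHeight≤ r H →
                        (D : Deconstruction H G) → Width≤ H G D k →
                        Elim (graph G) (replicate (suc r) k) Everything
  deconstruction⇒elim {r} {k} H G (_ , heights) D width =
    elim-componentwise {G = graph G} {ps = replicate (suc r) k} λ c _ →
      -- The whole component of `c` is located in the component of `h₀` in `H`, where the paths from
      -- the root `z` have length at most `r`.
      let h₀ , c∈h₀     = located c
          S             = component (graph H) h₀
          (z , z∈S) , short = heights S (component-isComponent (graph H) h₀)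
      in elim-located r (Walk (graph G) Everything c) (_∈ S) z z∈S
           (λ y∈S → walk-trans (walk-sym (component-walk (∈⟦⟧⁻ z∈S))) (component-walk (∈⟦⟧⁻ y∈S)))
           (λ p s p∈S → short
             (record { vertex   = λ i → vertex p i , p∈S i
                     ; distinct = λ eq → distinct p (cong proj₁ eq)
                     ; step     = step p })
             (member≡ s))
           (λ _ → tt)
           (λ w g∈y → ∈⟦⟧⁺ (walk-locations (λ _ → tt) (λ _ _ → tt) w c∈h₀ g∈y))
    where
    open Deconstruction D
    open Path
    located : ∀ g → ∃ λ h → g ∈ bag h
    located g with covers g g refl
    ... | h , h′ , _ , g∈ , _ = [ (h ,_) , (h′ ,_) ]′ (x∈p∪q⁻ (bag h) (bag h′) g∈)

    edge : ∀ {g g′} → Unit → Unit → SimpleGraph._~_ (graph G) g g′ →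
           ∃₂ λ y y′ → g ∈ bag y × g′ ∈ bag y′ × (y ≡ y′ ⊎ SimpleGraph._~_ (graph H) y y′)
    edge {g} {g′} _ _ e with covers g g′ [ e ]
    ... | h , h′ , h~h′ , g∈ , g′∈ with x∈p∪q⁻ (bag h) (bag h′) g∈ | x∈p∪q⁻ (bag h) (bag h′) g′∈
    ... | inj₁ g∈h  | inj₁ g′∈h  = h , h , g∈h , g′∈h , inj₁ refl
    ... | inj₂ g∈h′ | inj₂ g′∈h′ = h′ , h′ , g∈h′ , g′∈h′ , inj₁ refl
    ... | inj₁ g∈h  | inj₂ g′∈h′ = h , h′ , g∈h , g′∈h′ , adjacent h~h′
      where
      adjacent : ReflClosure (SimpleGraph._~_ (graph H)) h h′ → h ≡ h′ ⊎ SimpleGraph._~_ (graph H) h h′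
      adjacent refl  = inj₁ refl
      adjacent [ e ] = inj₂ e
    ... | inj₂ g∈h′ | inj₁ g′∈h  = h′ , h , g∈h′ , g′∈h , adjacent h~h′
      where
      adjacent : ReflClosure (SimpleGraph._~_ (graph H)) h h′ → h′ ≡ h ⊎ SimpleGraph._~_ (graph H) h′ h
      adjacent refl  = inj₁ refl
      adjacent [ e ] = inj₂ (SimpleGraph.~-sym (graph H) e)

    open Locate (graph H) ≡⊎≢ (graph G) Everything (λ g h → g ∈ bag h)
      (λ g _ → located g)
      (λ {g} {y} {y′} g∈y g∈y′ → walk-mono (∈location⁻ bag)
         (induced-star⇒walk (connected g (y , ∈location⁺ bag g∈y) (y′ , ∈location⁺ bag g∈y′))))
      edge bag
      (λ z → ≤-trans (∣p∣≤∣p∪q∣ (bag z) (bag z)) (width z z refl))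
      (λ g∈z → g∈z)

  -- A vertex is located at all its descendants in the tree `T`. These form a connected set, the two
  -- ends of an edge share the lower one as a location, and the bag of a vertex is the set of its
  -- ancestors.
  treeDepth⇒elim : ∀ {d} (G : Graph) → TreeDepth≤ G d →
                   Elim (graph G) (replicate (suc d) (suc d)) Everything
  treeDepth⇒elim {d} G td =
    elim-componentwise {G = graph G} {ps = replicate (suc d) (suc d)} λ c _ →
      connectedCase c (td (component (graph G) c) (component-isComponent (graph G) c))
    where
    connectedCase : ∀ c → ConnectedTreeDepth≤ (induced (graph G) (component (graph G) c)) d →
                    Elim (graph G) (replicate (suc d) (suc d)) (Walk (graph G) Everything c)
    connectedCase c (T , root , (conn , acyclic) , short , edges) =
      elim-located d (Walk (graph G) Everything c) Everything root tt
        (λ {y} _ → star⇒walk (conn root y)) (λ p s _ → short p s) (λ w → w) (λ _ _ → tt)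
      where
      open Path
      S : Subset (Graph.order G)
      S = component (graph G) c

      V : Set
      V = ∃ λ g → g ∈ S

      root-path : ∀ v → ∃₂ λ n (p : Path T n) → start p ≡ root × end p ≡ v
      root-path v = let n , p , s , e , _ = walk⇒path member-≡⊎≢ (star⇒walk (conn root v)) in n , p , s , e

      ancestor-refl : ∀ v → Ancestor T root v v
      ancestor-refl v = let n , p , s , e = root-path v in n , p , s , e , fromℕ n , e

      L : Fin (Graph.order G) → V → Set
      L g v = ∃ λ u → proj₁ u ≡ g × Ancestor T root u v

      walk-down : ∀ {u v} → Ancestor T root u v → Walk T (Ancestor T root u) u v
      walk-down (n , p , s , refl , i , refl) = walk-from-ancestor p s i

      L-connected : ∀ {g y y′} → L g y → L g y′ → Walk T (L g) y y′
      L-connected (u , refl , anc) (u′ , eq , anc′) with member≡ {x = u′} {y = u} eq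
      ... | refl = walk-mono (λ a → u , refl , a)
                     (walk-trans (walk-sym (walk-down anc)) (walk-down anc′))

      edge : ∀ {g g′} → Walk (graph G) Everything c g → Walk (graph G) Everything c g′ →
             SimpleGraph._~_ (graph G) g g′ →
             ∃₂ λ y y′ → L g y × L g′ y′ × (y ≡ y′ ⊎ SimpleGraph._~_ T y y′)
      edge {g} {g′} w w′ e with edges (g , ∈⟦⟧⁺ w) (g′ , ∈⟦⟧⁺ w′) e
      ... | inj₁ anc = _ , _ , (_ , refl , anc) , (_ , refl , ancestor-refl _) , inj₁ refl
      ... | inj₂ anc = _ , _ , (_ , refl , ancestor-refl _) , (_ , refl , anc) , inj₁ refl

      -- By `path-unique` all ancestors of `v` lie on one fixed path from the root, which has at
      -- most `suc d` vertices.
      ancestors≤ : ∀ v → ∣ ⟦ (λ g → L g v) ⟧ ∣ ≤ suc d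
      ancestors≤ v with root-path v
      ... | n , p , s , e = ≤-trans
        (range⇒∣q∣≤ (proj₁ ∘ vertex p) ⟦ (λ g → L g v) ⟧ on-path)
        (s≤s (short p s))
        where
        on-path : ∀ {g} → g ∈ ⟦ (λ g → L g v) ⟧ → ∃ λ i → proj₁ (vertex p i) ≡ g
        on-path g∈ with ∈⟦⟧⁻ g∈
        ... | u , refl , _ , q , s′ , e′ , i , eq =
          let j , eq′ = path-unique member-≡⊎≢ acyclic p q (trans s (sym s′)) (trans e (sym e′)) i
          in j , cong proj₁ (trans eq′ eq)

      located : ∀ g → Walk (graph G) Everything c g → ∃ (L g)
      located g w = v , v , refl , ancestor-refl v
        where
        v : V
        v = g , ∈⟦⟧⁺ w

      open Locate T member-≡⊎≢ (graph G) (Walk (graph G) Everything c) L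
        located L-connected edge (λ v → ⟦ (λ g → L g v) ⟧) ancestors≤ (λ Lgz → ∈⟦⟧⁺ Lgz)

  -- Canonical representatives of components

  module _ (G : SimpleGraph (Fin n)) (S : Pred (Fin n) 0ℓ) where

    private
      -- The vertex `a` is a default for the empty set only. Otherwise the choice depends on the set
      -- alone, which makes representatives equal within a component.
      pick : Fin n → Subset n → Fin n
      pick a X with nonempty? X
      ... | yes (x , _) = x
      ... | no  _       = a

      pick∈ : ∀ a X → a ∈ X → pick a X ∈ X
      pick∈ a X a∈X with nonempty? X
      ... | yes (x , x∈X) = x∈X
      ... | no  empty     = contradiction (a , a∈X) empty

      pick-default : ∀ a b X → a ∈ X → pick a X ≡ pick b X
      pick-default a b X a∈X with nonempty? X
      ... | yes _     = refl
      ... | no  empty = contradiction (a , a∈X) empty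

    rep : Fin n → Fin n
    rep a = pick a ⟦ Walk G S a ⟧

    rep-walk : ∀ {a} → S a → Walk G S a (rep a)
    rep-walk {a} Sa = ∈⟦⟧⁻ {P = Walk G S a} (pick∈ a ⟦ Walk G S a ⟧ (∈⟦⟧⁺ (stay Sa)))

    rep-cong : ∀ {a b} → Walk G S a b → rep a ≡ rep b
    rep-cong {a} {b} w = trans (pick-default a b ⟦ Walk G S a ⟧ (∈⟦⟧⁺ (stay (source∈ w))))
      (cong (pick b) (⊆-antisym
        (λ x∈ → ∈⟦⟧⁺ (walk-trans (walk-sym w) (∈⟦⟧⁻ x∈)))
        (λ x∈ → ∈⟦⟧⁺ (walk-trans w (∈⟦⟧⁻ x∈)))))

  -- Transfer of the game along a homomorphism

  pullback : ∀ {τ} {A A′ B : Structure τ} ((ρ , _) : Hom A A′) (ps : Vec ℕ m) g g′ →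
             (∀ {a} → a ∈ dom g → lookup g a ≡ lookup g′ (ρ a)) →
             DuplicatorWins A′ B ps g′ → DuplicatorWins A B ps g
  pullback {A = A} {A′} {B} (ρ , ρ-hom) = go
    where
    pullback-hom : ∀ g g′ → (∀ {a} → a ∈ dom g → lookup g a ≡ lookup g′ (ρ a)) →
                   IsPartialHom A′ B g′ → IsPartialHom A B g
    pullback-hom g g′ eq (inj₁ empty) = inj₁ (Empty-unique λ (a , a∈) →
      let b , eq′ = ∈dom⁻ g a∈ in
      ∉⊥ (subst (ρ a ∈_) empty (∈dom⁺ g′ (trans (sym (eq a∈)) eq′))))
    pullback-hom g g′ eq (inj₂ h) = inj₂ λ R t u Rt tu → h R _ u (ρ-hom R t Rt) (transfer t u tu)
      where
      transfer : ∀ {l} (t : Vec (Fin (size A)) l) u → Vec.map (lookup g) t ≡ Vec.map just u →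
                 Vec.map (lookup g′) (Vec.map ρ t) ≡ Vec.map just u
      transfer []      []      _  = refl
      transfer (a ∷ t) (b ∷ u) tu =
        let ab , tu′ = Vec-∷-injective tu in
        cong₂ _∷_ (trans (sym (eq (∈dom⁺ g ab))) ab) (transfer t u tu′)

    go : ∀ {m} (ps : Vec ℕ m) g g′ → (∀ {a} → a ∈ dom g → lookup g a ≡ lookup g′ (ρ a)) →
         DuplicatorWins A′ B ps g′ → DuplicatorWins A B ps g
    go []       g g′ eq win          = pullback-hom g g′ eq win
    go (p ∷ ps) g g′ eq (hom , win′) = pullback-hom g g′ eq hom , answer
      where
      answer : ∀ S → dom g ⊆ S → ∣ S ─ dom g ∣ ≤ p →
               ∃ λ g₁ → DuplicatorWins A B ps g₁ × g₁ Extends g × dom g₁ ≡ S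
      -- The new elements are sent to `A′` by `ρ`, which cannot increase their number, and the
      -- answer given there is composed with `ρ`.
      answer S D⊆S S≤p =
        let g₁′ , win₁ , ext′ , dom≡ = win′ S′ (λ x∈ → x∈p∪q⁺ (inj₁ x∈)) S′≤p
            g₁ = restrict S (lookup g₁′ ∘ ρ)
            total : ∀ {a} → a ∈ S → ∃ λ b → lookup g₁′ (ρ a) ≡ just b
            total a∈S = ∈dom⁻ g₁′ (subst (_ ∈_) (sym dom≡) (ρS⊆S′ a∈S))
            dom₁ = dom-restrict S (lookup g₁′ ∘ ρ) total
            agree : ∀ {a} → a ∈ S → lookup g₁ a ≡ lookup g₁′ (ρ a)
            agree = lookup-restrict S (lookup g₁′ ∘ ρ)
        in g₁
         , go ps g₁ g₁′ (λ {a} a∈ → agree (subst (a ∈_) dom₁ a∈)) win₁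
         , (λ a b ab → let a∈ = ∈dom⁺ g ab in
              trans (agree (D⊆S a∈)) (ext′ (ρ a) b (trans (sym (eq a∈)) ab)))
         , dom₁
        where
        new : Subset (size A′)
        new = ⟦ (λ b → ∃ λ a → a ∈ S ─ dom g × ρ a ≡ b) ⟧
        S′ : Subset (size A′)
        S′ = dom g′ ∪ new
        ρS⊆S′ : ∀ {a} → a ∈ S → ρ a ∈ S′
        ρS⊆S′ {a} a∈S with a ∈? dom g
        ... | yes a∈ = let b , ab = ∈dom⁻ g a∈ in
                       x∈p∪q⁺ (inj₁ (∈dom⁺ g′ (trans (sym (eq a∈)) ab)))
        ... | no  a∉ = x∈p∪q⁺ (inj₂ (∈⟦⟧⁺ (a , x∈p∧x∉q⇒x∈p─q a∈S a∉ , refl)))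
        new-only : S′ ─ dom g′ ⊆ new
        new-only x∈ with x∈p∪q⁻ (dom g′) new (p─q⊆p S′ (dom g′) x∈)
        ... | inj₁ x∈g′  = contradiction x∈g′ (x∈p─q⇒x∉q S′ (dom g′) x∈)
        ... | inj₂ x∈new = x∈new
        S′≤p : ∣ S′ ─ dom g′ ∣ ≤ p
        S′≤p = ≤-trans (p⊆q⇒∣p∣≤∣q∣ new-only)
                 (≤-trans (image⇒∣q∣≤∣p∣ ρ (S ─ dom g) new ∈⟦⟧⁻) S≤p)

  -- Homomorphisms from elimination

  module _ {τ : Vocabulary} (A B : Structure τ) where
    private
      G = graph (gaifman A)
      open SimpleGraph G

      b₀ : Fin (size B)
      b₀ = element (nonEmpty B)

      same-tuple : ∀ R t → rel A R t → ∀ i j → lookup t i ≡ lookup t j ⊎ lookup t i ~ lookup t j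
      same-tuple R t Rt i j with ≡⊎≢ (lookup t i) (lookup t j)
      ... | inj₁ eq = inj₁ eq
      ... | inj₂ ne = inj₂ (ne , R , t , Rt , ∈-lookup i t , ∈-lookup j t)

    -- Only tuples meeting `C` are tested. The entries of a tuple are pairwise equal or adjacent, so
    -- it meets at most one component of `C`, and solutions for the components can be glued.
    Solution : PartialMap (size A) (size B) → Pred (Fin (size A)) 0ℓ →
               (Fin (size A) → Fin (size B)) → Set
    Solution g C f = (∀ {a b} → lookup g a ≡ just b → f a ≡ b) ×
                     (∀ R t → rel A R t → ∀ i → C (lookup t i) → rel B R (Vec.map f t))

    -- The spoiler's moves in the components of C are independent of each
    -- other, so the answers to all of them fit together.
    solve : ∀ (ps : Vec ℕ m) g C → DuplicatorWins A B ps g → Elim G ps C →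
            (∀ {a b} → C a → a ~ b → C b ⊎ b ∈ dom g) → ∃ (Solution g C)
    solve []       g C win E closed =
        (λ a → fromMaybe b₀ (lookup g a))
      , (λ eq → cong (fromMaybe b₀) eq)
      , λ R t Rt i Ci → contradiction Ci (E _)
    solve (p ∷ ps) g C (_ , win) E closed =
      f , f-agrees , f-hom
      where
      local : ∀ c → C c → ∃ (Solution g (Walk G C c))
      local c Cc with E c Cc
      ... | X , X≤p , EX with win (dom g ∪ X) (λ x∈ → x∈p∪q⁺ (inj₁ x∈))
                               (≤-trans (p⊆q⇒∣p∣≤∣q∣ X-only) X≤p)
        where
        X-only : (dom g ∪ X) ─ dom g ⊆ X
        X-only x∈ with x∈p∪q⁻ (dom g) X (p─q⊆p (dom g ∪ X) (dom g) x∈)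
        ... | inj₁ x∈g = contradiction x∈g (x∈p─q⇒x∉q (dom g ∪ X) (dom g) x∈)
        ... | inj₂ x∈X = x∈X
      ...   | g₁ , win₁ , ext , dom≡ = f₁ , (λ eq → agrees₁ (ext _ _ eq)) , hom
        where
        C₁ : Pred (Fin (size A)) 0ℓ
        C₁ a = Walk G C c a × a ∉ X

        near : ∀ {a} → Walk G C c a → ∀ {b} → a ≡ b ⊎ a ~ b → C₁ b ⊎ b ∈ dom g₁
        near w {b} eq⊎e with b ∈? X
        ... | yes b∈X = inj₂ (subst (b ∈_) (sym dom≡) (x∈p∪q⁺ (inj₂ b∈X)))
        near w (inj₁ refl) | no b∉X = inj₁ (w , b∉X)
        near w {b} (inj₂ e) | no b∉X with closed (target∈ w) e
        ... | inj₁ Cb  = inj₁ (walk-snoc w e Cb , b∉X)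
        ... | inj₂ b∈g = inj₂ (subst (b ∈_) (sym dom≡) (x∈p∪q⁺ (inj₁ b∈g)))

        rec : ∃ (Solution g₁ C₁)
        rec = solve ps g₁ C₁ win₁ EX (λ (w , _) e → near w (inj₂ e))

        f₁ = proj₁ rec
        agrees₁ = proj₁ (proj₂ rec)

        hom : ∀ R t → rel A R t → ∀ i → Walk G C c (lookup t i) → rel B R (Vec.map f₁ t)
        -- A tuple meeting `C₁` is covered by the recursion; any other lies wholly in the domain of
        -- `g₁`, where `f₁` agrees with a partial homomorphism.
        hom R t Rt i w with em {∃ λ j → C₁ (lookup t j)}
        ... | yes (j , C₁j) = proj₂ (proj₂ rec) R t Rt j C₁j
        ... | no  none      with wins⇒partialHom A B ps win₁
        ...   | inj₁ empty = contradiction (subst (lookup t i ∈_) empty (inside₁ i)) ∉⊥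
          where
          inside₁ : ∀ j → lookup t j ∈ dom g₁
          inside₁ j = [ (λ C₁j → contradiction (j , C₁j) none) , id ]′ (near w (same-tuple R t Rt i j))
        ...   | inj₂ h = h R t (Vec.map f₁ t) Rt (vec-ext λ j → begin
            lookup (Vec.map (lookup g₁) t) j         ≡⟨ lookup-map j (lookup g₁) t ⟩
            lookup g₁ (lookup t j)                   ≡⟨ value j ⟩
            just (f₁ (lookup t j))                   ≡⟨ cong just (lookup-map j f₁ t) ⟨
            just (lookup (Vec.map f₁ t) j)           ≡⟨ lookup-map j just (Vec.map f₁ t) ⟨
            lookup (Vec.map just (Vec.map f₁ t)) j   ∎)
          where
          open ≡-Reasoning
          value : ∀ j → lookup g₁ (lookup t j) ≡ just (f₁ (lookup t j))
          value j with near w (same-tuple R t Rt i j)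
          ... | inj₁ C₁j = contradiction (j , C₁j) none
          ... | inj₂ j∈  = let b , eq = ∈dom⁻ g₁ j∈ in trans eq (cong just (sym (agrees₁ eq)))

      local′ : ∀ c → ∃ λ f → C c → Solution g (Walk G C c) f
      local′ c with em {C c}
      ... | yes Cc = let f , sol = local c Cc in f , λ _ → sol
      ... | no ¬Cc = (λ _ → b₀) , λ Cc → contradiction Cc ¬Cc

      -- All vertices of one component take their values from the same solution, the one chosen for
      -- the representative. Outside `C` the map `g` is followed, with default `b₀`.
      f? : ∀ a → Dec (C a) → Fin (size B)
      f? a (yes _) = proj₁ (local′ (rep G C a)) a
      f? a (no  _) = fromMaybe b₀ (lookup g a)

      f : Fin (size A) → Fin (size B)
      f a = f? a em

      rep∈ : ∀ {a} → C a → C (rep G C a)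
      rep∈ Ca = target∈ (rep-walk G C Ca)

      f-agrees : ∀ {a b} → lookup g a ≡ just b → f a ≡ b
      f-agrees {a} eq with em {C a}
      ... | yes Ca = proj₁ (proj₂ (local′ (rep G C a)) (rep∈ Ca)) eq
      ... | no  _  = cong (fromMaybe b₀) eq

      f-hom : ∀ R t → rel A R t → ∀ i → C (lookup t i) → rel B R (Vec.map f t)
      f-hom R t Rt i Ci = subst (rel B R) (vec-ext λ j →
          trans (lookup-map j f₁ t) (trans (sym (value j)) (sym (lookup-map j f t))))
        (proj₂ (proj₂ (local′ c) (rep∈ Ci)) R t Rt i (walk-sym (rep-walk G C Ci)))
        where
        c = rep G C (lookup t i)
        f₁ = proj₁ (local′ c)
        value : ∀ j → f (lookup t j) ≡ f₁ (lookup t j)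
        value j with em {C (lookup t j)} | same-tuple R t Rt i j
        ... | yes _   | inj₁ eq = cong (λ a → proj₁ (local′ (rep G C a)) (lookup t j)) (sym eq)
        ... | yes Cj  | inj₂ e  =
          cong (λ a → proj₁ (local′ a) (lookup t j)) (sym (rep-cong G C (move Ci e (stay Cj))))
        ... | no  ¬Cj | inj₁ eq = contradiction (subst C eq Ci) ¬Cj
        ... | no  ¬Cj | inj₂ e  with closed Ci e
        ...   | inj₁ Cj  = contradiction Cj ¬Cj
        ...   | inj₂ j∈g = let b , eq = ∈dom⁻ g j∈g in
                trans (cong (fromMaybe b₀) eq) (sym (proj₁ (proj₂ (local′ c) (rep∈ Ci)) eq))

    elim⇒hom : ∀ {k r} → 1 ≤ k → Elim G (replicate (suc r) k) Everything →
               DuplicatorWins A B (replicate (suc r) k) ∅ → Hom A B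
    elim⇒hom {k} {r} 1≤k E win = f , f-hom
      where
      solution = solve (replicate (suc r) k) ∅ Everything win E (λ _ _ → inj₁ tt)
      f = proj₁ solution

      a₀ : Fin (size A)
      a₀ = element (nonEmpty A)

      f-hom : IsHom A B f
      -- A nullary tuple meets no component. For it one move on `a₀`, permitted by `1≤k`, provides a
      -- partial homomorphism with non-empty domain.
      f-hom R t Rt with Fin? (arity τ R)
      ... | inj₁ i = proj₂ (proj₂ solution) R t Rt i tt
      ... | inj₂ nullary with proj₂ win ⁅ a₀ ⁆ (λ {x} x∈ → contradiction (subst (x ∈_) dom-∅ x∈) ∉⊥)
                                (≤-trans (∣p─q∣≤∣p∣ ⁅ a₀ ⁆ (dom ∅)) (≤-trans (≤-reflexive (∣⁅x⁆∣≡1 a₀)) 1≤k))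
      ...   | g , win₁ , _ , dom≡ with wins⇒partialHom A B (replicate r k) win₁
      ...     | inj₁ empty = contradiction (subst (a₀ ∈_) (trans (sym dom≡) empty) (x∈⁅x⁆ a₀)) ∉⊥
      ...     | inj₂ h     = h R t (Vec.map f t) Rt (vec-ext λ i → contradiction i nullary)

  -- Cores

  -- If every point were hit, each would have a preimage other than `a`, with `a′` replacing `a`
  -- where necessary; this would inject `suc n` points into `n`.
  missed : (f : Fin (suc n) → Fin (suc n)) → ∀ {a a′} → a ≢ a′ → f a ≡ f a′ →
           ∃ λ b → ∀ x → b ≢ f x
  missed {n} f {a} {a′} a≢a′ fa≡fa′ with em {∃ λ b → ∀ x → b ≢ f x}
  ... | yes found = found
  ... | no  none  = contradiction (injective⇒≤ {f = section} section-injective) (<⇒≱ ≤-refl)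
    where
    preimage : ∀ b → ∃ λ x → a ≢ x × f x ≡ b
    preimage b with em {∃ λ x → f x ≡ b}
    ... | no  ∄x = contradiction (b , λ x b≡ → ∄x (x , sym b≡)) none
    ... | yes (x , fx≡b) with a ≟ᶠ x
    ...   | yes refl = a′ , a≢a′ , trans (sym fa≡fa′) fx≡b
    ...   | no  a≢x  = x , a≢x , fx≡b

    section : Fin (suc n) → Fin n
    section b = punchOut (proj₁ (proj₂ (preimage b)))

    section-injective : Injective _≡_ _≡_ section
    section-injective {b} {b′} eq =
      let x , a≢x , fx = preimage b ; x′ , a≢x′ , fx′ = preimage b′ in
      trans (sym fx) (trans (cong f (punchOut-injective a≢x a≢x′ eq)) fx′)

  -- A non-injective endomorphism misses some `b`, hence is a homomorphism into the smaller
  -- substructure without `b`; recursion on the size ends at a core.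
  core-exists : ∀ {τ} (A : Structure τ) → ∃ λ B → B IsCoreOf A
  core-exists {τ} A = go (size A) A refl
    where
    go : ∀ s (A : Structure τ) → size A ≡ s → ∃ λ B → B IsCoreOf A
    go s A size≡ with em {∃ λ f → IsHom A A f × ∃₂ λ a a′ → a ≢ a′ × f a ≡ f a′}
    ... | no injective = A , record
          { embed           = id
          ; embed-injective = id
          ; embed-hom       = λ R t → subst (rel A R) (sym (map-id t))
          ; retract         = id , λ R t → subst (rel A R) (sym (map-id t))
          ; isCore          = λ f f-hom {a} {a′} eq →
              [ id , (λ ne → contradiction (f , f-hom , a , a′ , ne , eq) injective) ]′ (≡⊎≢ a a′)
          }
    go .(suc n) record { size = suc n ; rel = rel } refl | yes (f , f-hom , a , a′ , a≢a′ , eq) =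
      proj₁ smaller , record
        { embed           = punchIn b ∘ embed
        ; embed-injective = embed-injective ∘ punchIn-injective b _ _
        ; embed-hom       = λ R t Rt → subst (rel R) (sym (map-∘ (punchIn b) embed t)) (embed-hom R t Rt)
        ; retract         = proj₁ retract ∘ f₁ , λ R t Rt →
            subst (Structure.rel (proj₁ smaller) R) (sym (map-∘ (proj₁ retract) f₁ t))
              (proj₂ retract R _ (subst (rel R)
                (trans (map-cong (λ x → sym (punchIn-punchOut (b∉f x))) t) (map-∘ (punchIn b) f₁ t))
                (f-hom R t Rt)))
        ; isCore          = isCore
        }
      where
      b = proj₁ (missed f a≢a′ eq)
      b∉f = proj₂ (missed f a≢a′ eq)
      f₁ : Fin (suc n) → Fin n
      f₁ x = punchOut (b∉f x)
      A₁ : Structure τ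
      A₁ = record { size = n ; nonEmpty = nonZeroIndex (f₁ a) ; rel = λ R t → rel R (Vec.map (punchIn b) t) }
      smaller = go n A₁ refl
      open _IsCoreOf_ (proj₂ smaller)

  -- The twisted structure

  module Twisted {τ : Vocabulary} (A : Structure τ) (a₀ : Fin (size A)) where
    private
      N = size A
      G = graph (gaifman A)
      open SimpleGraph G

    adj : Fin N → Fin N → Bool
    adj a b = does (em {a ~ b})

    adj-~ : ∀ {a b} → a ~ b → adj a b ≡ true
    adj-~ = dec-true em

    private
      toBool : Fin 2 → Bool
      toBool zero    = false
      toBool (suc _) = true

      fromBool : Bool → Fin 2
      fromBool false = zero
      fromBool true  = suc zero

      toBool-fromBool : ∀ b → toBool (fromBool b) ≡ b
      toBool-fromBool false = refl
      toBool-fromBool true  = refl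

    -- An element of the twisted structure is an element of A together with a
    -- bit for every other element (relevant only for its neighbours).
    π : Fin (N * 2 ^ N) → Fin N
    π = quotient (2 ^ N)

    bit : Fin (N * 2 ^ N) → Fin N → Bool
    bit e b = toBool (finToFun (remainder {N} (2 ^ N) e) b)

    encode : Fin N → (Fin N → Bool) → Fin (N * 2 ^ N)
    encode a F = combine a (funToFin (fromBool ∘ F))

    π-encode : ∀ a F → π (encode a F) ≡ a
    π-encode a F = cong proj₁ (remQuot-combine {N} a (funToFin (fromBool ∘ F)))

    bit-encode : ∀ a F b → bit (encode a F) b ≡ F b
    bit-encode a F b = begin
      bit (encode a F) b
        ≡⟨ cong (λ qr → toBool (finToFun (proj₂ qr) b)) (remQuot-combine {N} a (funToFin (fromBool ∘ F))) ⟩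
      toBool (finToFun (funToFin (fromBool ∘ F)) b)
        ≡⟨ cong toBool (finToFun-funToFin (fromBool ∘ F) b) ⟩
      toBool (fromBool (F b))
        ≡⟨ toBool-fromBool (F b) ⟩
      F b ∎
      where open ≡-Reasoning

    -- The bits at an element are proposed labels of its incident edges. As in a Tseitin system, the
    -- required parity is odd at `a₀` and even elsewhere.
    Balanced : Fin (N * 2 ^ N) → Set
    Balanced e = sum (λ b → adj (π e) b ∧ bit e b) ≡ δ a₀ (π e)

    Consistent : Fin (N * 2 ^ N) → Fin (N * 2 ^ N) → Set
    Consistent e e′ = π e ~ π e′ → bit e (π e′) ≡ bit e′ (π e)

    twisted : Structure τ
    twisted = record
      { size     = N * 2 ^ N
      ; nonEmpty = m*n≢0 N (2 ^ N) {{nonEmpty A}} {{m^n≢0 2 N}}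
      ; rel      = λ R u → rel A R (Vec.map π u) × (∀ i → Balanced (lookup u i)) ×
                           (∀ i j → Consistent (lookup u i) (lookup u j))
      }

    Occurs : Fin N → Set
    Occurs a = ∃₂ λ R t → rel A R t × ∃ λ i → lookup t i ≡ a

    -- A homomorphism over the identity of A would give a symmetric matrix of
    -- bits with zero diagonal whose total parity is odd.
    no-section : (∀ a → Occurs a) → (h : Fin N → Fin (size twisted)) → IsHom A twisted h →
                 (∀ a → π (h a) ≡ a) → Absurd
    no-section occurs h h-hom πh≡ = contradiction
      (trans (sym total-odd) (sum-symmetric M M-sym M-diag)) λ ()
      where
      M : Fin N → Fin N → Bool
      M a b = adj a b ∧ bit (h a) b

      row : ∀ a → sum (M a) ≡ δ a₀ a
      -- Balance is imposed only on entries of tuples, so a tuple containing `a` is needed.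
      row a with occurs a
      ... | R , t , Rt , i , refl =
        subst (λ a → sum (λ b → adj a b ∧ bit (h (lookup t i)) b) ≡ δ a₀ a) (πh≡ (lookup t i))
          (subst Balanced (lookup-map i h t) (proj₁ (proj₂ (h-hom R t Rt)) i))

      total-odd : sum (λ a → sum (M a)) ≡ true
      total-odd = trans (sum-cong-≗ λ a → trans (row a) (sym (∧-identityʳ (δ a₀ a)))) (sum-δ (λ _ → true) a₀)

      bits-agree : ∀ {a b} → a ~ b → bit (h a) b ≡ bit (h b) a
      bits-agree {a} {b} e@(_ , R , t , Rt , a∈t , b∈t) =
        subst₂ (λ x y → bit (h a) x ≡ bit (h b) y) (πh≡ b) (πh≡ a)
          (subst₂ Consistent (entry a∈t) (entry b∈t)
             (proj₂ (proj₂ (h-hom R t Rt)) (index a∈t) (index b∈t))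
             (subst₂ _~_ (sym (πh≡ a)) (sym (πh≡ b)) e))
        where
        entry : ∀ {a} (a∈t : a ∈ᵛ t) → lookup (Vec.map h t) (index a∈t) ≡ h a
        entry a∈t = trans (lookup-map (index a∈t) h t) (cong h (sym (lookup-index a∈t)))

      M-sym : ∀ a b → M a b ≡ M b a
      M-sym a b with em {a ~ b} | em {b ~ a}
      ... | yes e | yes _  = bits-agree e
      ... | yes e | no ¬e′ = contradiction (~-sym e) ¬e′
      ... | no ¬e | yes e′ = contradiction (~-sym e′) ¬e
      ... | no _  | no _   = refl

      M-diag : ∀ a → M a a ≡ false
      M-diag a = cong (_∧ bit (h a) a) (dec-false em (~-irrefl refl))

    -- In a core the endomorphism `π ∘ h` is injective, hence of finite order; `h` composed with a
    -- suitable power of it is a section of `π`.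
    no-hom : IsCore A → (∀ a → Occurs a) → ¬ Hom A twisted
    no-hom core occurs (h , h-hom) with injective⇒periodic (π ∘ h) (core (π ∘ h) φ-hom)
      where
      φ-hom : IsHom A A (π ∘ h)
      φ-hom = hom-∘ {A = A} {twisted} {A} (λ R u → proj₁) h-hom
    ... | d , period = no-section occurs (λ x → h (fold x (π ∘ h) d))
            (hom-∘ {A = A} {A} {twisted} h-hom (fold-hom {A = A} φ-hom d)) period
      where
      φ-hom : IsHom A A (π ∘ h)
      φ-hom = hom-∘ {A = A} {twisted} {A} (λ R u → proj₁) h-hom

    -- A labelling of the edges all of whose vertices but c are balanced.
    Labelling : (Fin N → Fin N → Bool) → Fin N → Set
    Labelling x c = (∀ a b → x a b ≡ x b a) ×
                    (∀ a → sum (λ b → adj a b ∧ x a b) ≡ δ a₀ a xor δ c a)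

    trivial-labelling : Labelling (λ _ _ → false) a₀
    trivial-labelling = (λ _ _ → refl) , λ a →
      trans (trans (sum-cong-≗ λ b → ∧-zeroʳ (adj a b)) (sum-replicate-zero N)) (sym (xor-same (δ a₀ a)))

    -- Flipping the bit of the edge between `u` and `w` changes the parities at these two vertices
    -- only, which moves the defect from `u` to `w`.
    shift-edge : ∀ {x u w} → u ~ w → Labelling x u →
                 ∃ λ x′ → Labelling x′ w × (∀ {a} → a ≢ u → a ≢ w → ∀ b → x′ a b ≡ x a b)
    shift-edge {x} {u} {w} u~w (x-sym , x-sum) = x′ , (x′-sym , x′-sum) , x′≡x
      where
      x′ : Fin N → Fin N → Bool
      x′ a b = x a b xor ((δ u a ∧ δ w b) xor (δ w a ∧ δ u b))

      x′-sym : ∀ a b → x′ a b ≡ x′ b a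
      x′-sym a b = cong₂ _xor_ (x-sym a b)
        (trans (xor-comm (δ u a ∧ δ w b) (δ w a ∧ δ u b))
               (cong₂ _xor_ (∧-comm (δ w a) (δ u b)) (∧-comm (δ u a) (δ w b))))

      δ∧adj : ∀ {u w} → u ~ w → ∀ a → δ u a ∧ adj a w ≡ δ u a
      δ∧adj {u} u~w a with u ≟ᶠ a
      ... | yes refl = adj-~ u~w
      ... | no  _    = refl

      x′-sum : ∀ a → sum (λ b → adj a b ∧ x′ a b) ≡ δ a₀ a xor δ w a
      x′-sum a = begin
        sum (λ b → adj a b ∧ x′ a b)
          ≡⟨ sum-cong-≗ (λ b → distribute-flip (adj a b) (x a b) (δ u a) (δ w b) (δ w a) (δ u b)) ⟩
        sum (λ b → (adj a b ∧ x a b) xor ((δ w b ∧ (δ u a ∧ adj a b)) xor (δ u b ∧ (δ w a ∧ adj a b))))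
          ≡⟨ ∑-distrib-+ (λ b → adj a b ∧ x a b) _ ⟩
        sum (λ b → adj a b ∧ x a b) xor sum (λ b → (δ w b ∧ (δ u a ∧ adj a b)) xor (δ u b ∧ (δ w a ∧ adj a b)))
          ≡⟨ cong₂ _xor_ (x-sum a) (∑-distrib-+ (λ b → δ w b ∧ (δ u a ∧ adj a b)) _) ⟩
        (δ a₀ a xor δ u a) xor (sum (λ b → δ w b ∧ (δ u a ∧ adj a b)) xor sum (λ b → δ u b ∧ (δ w a ∧ adj a b)))
          ≡⟨ cong₂ (λ p q → (δ a₀ a xor δ u a) xor (p xor q))
               (trans (sum-δ (λ b → δ u a ∧ adj a b) w) (δ∧adj u~w a))
               (trans (sum-δ (λ b → δ w a ∧ adj a b) u) (δ∧adj (~-sym u~w) a)) ⟩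
        (δ a₀ a xor δ u a) xor (δ u a xor δ w a)
          ≡⟨ cancel-middle (δ a₀ a) (δ u a) (δ w a) ⟩
        δ a₀ a xor δ w a ∎
        where open ≡-Reasoning

      x′≡x : ∀ {a} → a ≢ u → a ≢ w → ∀ b → x′ a b ≡ x a b
      x′≡x {a} a≢u a≢w b = trans
        (cong₂ (λ p q → x a b xor ((p ∧ δ w b) xor (q ∧ δ u b))) (δ-≢ (≢-sym a≢u)) (δ-≢ (≢-sym a≢w)))
        (xor-identityʳ (x a b))

    shift-walk : ∀ {S c c′ x} → Walk G S c c′ → Labelling x c →
                 ∃ λ x′ → Labelling x′ c′ × (∀ {a} → ¬ S a → ∀ b → x′ a b ≡ x a b)
    shift-walk (stay _) lab = _ , lab , λ _ _ → refl
    shift-walk {S} (move Sc e w) lab =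
      let x₁ , lab₁ , same₁ = shift-edge e lab
          x₂ , lab₂ , same₂ = shift-walk w lab₁
      in x₂ , lab₂ , λ ¬Sa b → trans (same₂ ¬Sa b)
           (same₁ (λ { refl → ¬Sa Sc }) (λ { refl → ¬Sa (source∈ w) }) b)

    Follows : PartialMap N (size twisted) → (Fin N → Fin N → Bool) → Set
    Follows g x = ∀ {a e} → lookup g a ≡ just e → π e ≡ a × (∀ b → bit e b ≡ x a b)

    -- The defect `c` lies outside the domain, so all images are balanced; they are consistent
    -- because `x` is symmetric.
    follows⇒partialHom : ∀ {g x c} → Labelling x c → Follows g x → c ∉ dom g → IsPartialHom A twisted g
    follows⇒partialHom {g} {x} {c} (x-sym , x-sum) follows c∉ = inj₂ λ R t u Rt tu →
      let value : ∀ i → lookup g (lookup t i) ≡ just (lookup u i)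
          value i = trans (sym (lookup-map i (lookup g) t))
                      (trans (cong (λ v → lookup v i) tu) (lookup-map i just u))
          π≡ = λ i → proj₁ (follows (value i))
          bit≡ = λ i → proj₂ (follows (value i))
      in subst (rel A R) (vec-ext λ i → sym (trans (lookup-map i π u) (π≡ i))) Rt
       , (λ i → balanced (value i))
       , λ i j _ → trans (bit≡ i (π (lookup u j))) (trans (cong₂ x (sym (π≡ i)) (π≡ j))
            (trans (x-sym _ _) (trans (cong (x _) (π≡ i)) (sym (trans (bit≡ j _) (cong (x _) (π≡ i)))))))
      where
      balanced : ∀ {a e} → lookup g a ≡ just e → Balanced e
      balanced {a} {e} eq with follows eq
      ... | refl , bit≡ = begin
        sum (λ b → adj a b ∧ bit e b)  ≡⟨ sum-cong-≗ (λ b → cong (adj a b ∧_) (bit≡ b)) ⟩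
        sum (λ b → adj a b ∧ x a b)    ≡⟨ x-sum a ⟩
        δ a₀ a xor δ c a               ≡⟨ cong (δ a₀ a xor_) (δ-≢ {a = c} {a} λ { refl → c∉ (∈dom⁺ g eq) }) ⟩
        δ a₀ a xor false               ≡⟨ xor-identityʳ (δ a₀ a) ⟩
        δ a₀ a                         ∎
        where open ≡-Reasoning

  -- Duplicator's strategy where the spoiler cannot win

  module _ (G : SimpleGraph (Fin n)) where

    -- The duplicator has just chosen the component `C` and the spoiler is to move. With no rounds
    -- left, having a component to stand in suffices.
    Alive : Vec ℕ m → Pred (Fin n) 0ℓ → Set
    Alive []       C = Unit
    Alive (p ∷ ps) C = ∀ X → ∣ X ∣ ≤ p → ¬ Elim G ps (λ a → C a × a ∉ X)

    ¬elim⇒alive : ∀ (ps : Vec ℕ m) {S} → ¬ Elim G ps S → ∃ λ c → S c × Alive ps (Walk G S c)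
    ¬elim⇒alive [] {S} ¬E with em {∃ S}
    ... | yes (c , Sc) = c , Sc , tt
    ... | no  none     = contradiction (λ a Sa → none (a , Sa)) ¬E
    ¬elim⇒alive (p ∷ ps) {S} ¬E with em {∃ λ c → S c × Alive (p ∷ ps) (Walk G S c)}
    ... | yes found = found
    ... | no  none  = contradiction E ¬E
      where
      E : Elim G (p ∷ ps) S
      E c Sc with em {∃ λ X → ∣ X ∣ ≤ p × Elim G ps (λ a → Walk G S c a × a ∉ X)}
      ... | yes found′ = found′
      ... | no  none′  = contradiction (c , Sc , λ X X≤p EX → none′ (X , X≤p , EX)) none

  module _ {τ : Vocabulary} (A : Structure τ) (a₀ : Fin (size A)) where
    open Twisted A a₀
    private
      G = graph (gaifman A)

    -- The duplicator keeps the unbalanced vertex in a component in which the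
    -- spoiler cannot win.
    alive⇒wins : ∀ (ps : Vec ℕ m) g x c S → Labelling x c → Follows g x →
                 S c → (∀ {a} → S a → a ∉ dom g) → Alive G ps (Walk G S c) →
                 DuplicatorWins A twisted ps g
    alive⇒wins []       g x c S lab follows Sc S∌g alive = follows⇒partialHom lab follows (S∌g Sc)
    alive⇒wins (p ∷ ps) g x c S lab follows Sc S∌g alive =
      follows⇒partialHom lab follows (S∌g Sc) , answer
      where
      answer : ∀ D → dom g ⊆ D → ∣ D ─ dom g ∣ ≤ p →
               ∃ λ g′ → DuplicatorWins A twisted ps g′ × g′ Extends g × dom g′ ≡ D
      -- The new elements are read as the spoiler's deletion. The defect then walks inside `S`, away
      -- from the domain of `g`, to a component that is still alive, so earlier answers remain
      -- valid.
      answer D g⊆D D≤p with ¬elim⇒alive G ps (alive (D ─ dom g) D≤p)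
      ... | c′ , (w , c′∉) , alive′ with shift-walk w lab
      ...   | x′ , lab′ , same = g′ , wins , extends , dom≡
        where
        f : Fin (size A) → Maybe (Fin (size twisted))
        f a with a ∈? dom g
        ... | yes _ = lookup g a
        ... | no  _ = just (encode a (x′ a))

        f-total : ∀ {a} → a ∈ D → ∃ λ b → f a ≡ just b
        f-total {a} _ with a ∈? dom g
        ... | yes a∈ = ∈dom⁻ g a∈
        ... | no  _  = _ , refl

        f-follows : ∀ {a e} → f a ≡ just e → π e ≡ a × (∀ b → bit e b ≡ x′ a b)
        f-follows {a} eq with a ∈? dom g
        ... | yes a∈ = let πe , bits = follows eq in
              πe , λ b → trans (bits b) (sym (same (λ Sa → S∌g Sa a∈) b))
        f-follows {a} refl | no _ = π-encode a (x′ a) , bit-encode a (x′ a)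

        g′ : PartialMap (size A) (size twisted)
        g′ = restrict D f

        dom≡ : dom g′ ≡ D
        dom≡ = dom-restrict D f f-total

        extends : g′ Extends g
        extends a b eq with ∈dom⁺ g eq
        ... | a∈ = trans (lookup-restrict D f (g⊆D a∈)) f≡
          where
          f≡ : f a ≡ just b
          f≡ with a ∈? dom g
          ... | yes _  = eq
          ... | no  a∉ = contradiction a∈ a∉

        wins : DuplicatorWins A twisted ps g′
        wins = alive⇒wins ps g′ x′ c′ (λ a → Walk G S c a × a ∉ D ─ dom g) lab′
          (λ {a} eq → f-follows (trans (sym (lookup-restrict D f (subst (a ∈_) dom≡ (∈dom⁺ g′ eq)))) eq))
          (w , c′∉)
          (λ {a} (v , a∉) a∈g′ → a∉ (x∈p∧x∉q⇒x∈p─q (subst (a ∈_) dom≡ a∈g′) (S∌g (target∈ v))))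
          alive′

  ¬elim⇒wins : ∀ {τ} (A : Structure τ) (v : Vec ℕ m) → ¬ Elim (graph (gaifman A)) v Everything →
               ∃ λ a₀ → DuplicatorWins A (Twisted.twisted A a₀) v ∅
  ¬elim⇒wins A v ¬E with ¬elim⇒alive (graph (gaifman A)) v ¬E
  ... | c , _ , alive = c , alive⇒wins A c v ∅ (λ _ _ → false) c Everything
          (Twisted.trivial-labelling A c)
          (λ {a} eq → contradiction (trans (sym (lookup-replicate a nothing)) eq) λ ())
          tt (λ {a} _ a∈ → ∉⊥ (subst (a ∈_) dom-∅ a∈)) alive

  -- An element of a core which is in no tuple could be mapped anywhere.
  core-occurs : ∀ {τ} (A : Structure τ) → IsCore A →
                (∀ a → ∃₂ λ R t → rel A R t × ∃ λ i → lookup t i ≡ a) ⊎ (∃ λ a → ∀ b → b ≡ a)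
  core-occurs A core with em {∃ λ a → ¬ (∃₂ λ R t → rel A R t × ∃ λ i → lookup t i ≡ a)}
  ... | no  none = inj₁ occurs
    where
    occurs : ∀ a → ∃₂ λ R t → rel A R t × ∃ λ i → lookup t i ≡ a
    occurs a with em {∃₂ λ R t → rel A R t × ∃ λ i → lookup t i ≡ a}
    ... | yes found = found
    ... | no  ¬occ  = contradiction (a , ¬occ) none
  ... | yes (a , free) = inj₂ (a , λ b → core (f b) (f-hom b) (collapse b))
    where
    f : Fin (size A) → Fin (size A) → Fin (size A)
    f b x with x ≟ᶠ a
    ... | yes _ = b
    ... | no  _ = x

    f-≢ : ∀ b {x} → x ≢ a → f b x ≡ x
    f-≢ b {x} x≢a with x ≟ᶠ a
    ... | yes eq = contradiction eq x≢a
    ... | no  _  = refl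

    collapse : ∀ b → f b b ≡ f b a
    collapse b with b ≟ᶠ a | a ≟ᶠ a
    ... | yes _ | yes _ = refl
    ... | no  _ | yes _ = refl
    ... | _     | no ne = contradiction refl ne

    f-hom : ∀ b → IsHom A A (f b)
    f-hom b R t Rt = subst (rel A R)
      (vec-ext λ i → sym (trans (lookup-map i (f b) t) (f-≢ b λ eq → free (R , t , Rt , i , eq)))) Rt

  -- Elimination from a solving game vector

  bounded : (v : Vec ℕ m) → ∃ λ k → 1 ≤ k × Pointwise _≤_ v (replicate m k)
  bounded []      = 1 , ≤-refl , []
  bounded (p ∷ v) =
    let k , 1≤k , v≤k = bounded v in
    p ⊔ k , ≤-trans 1≤k (m≤n⊔m p k) ,
    m≤m⊔n p k ∷ Pointwise.trans ≤-trans v≤k (replicate-mono _ (m≤n⊔m p k))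

  -- If the spoiler loses on the core `B`, Duplicator wins against the twisted copy of `B`, and
  -- along the retraction also from `A`. The resulting homomorphism, restricted to `B`, contradicts
  -- `no-hom`.
  solves⇒elim : ∀ {r} (𝒜 : StructureClass ℓ) (v : Vec ℕ (suc r)) → GameSolves v 𝒜 →
                ∃ λ k → 1 ≤ k × (∀ G → CoreGraphs 𝒜 G → Elim (graph G) (replicate (suc r) k) Everything)
  solves⇒elim {r = r} 𝒜 v solves = K , 1≤K , elim
    where
    K = proj₁ (bounded v)
    1≤K = proj₁ (proj₂ (bounded v))

    elim : ∀ G → CoreGraphs 𝒜 G → Elim (graph G) (replicate (suc r) K) Everything
    elim _ (coreGraph {A = A} {B} A∈𝒜 B-core) with em {Elim (graph (gaifman B)) v Everything}
    ... | yes E = elim-mono (proj₂ (proj₂ (bounded v))) id E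
    ... | no ¬E with core-occurs B (_IsCoreOf_.isCore B-core)
    -- A core with an element in no tuple has just this element, and the spoiler deletes it at once.
    ...   | inj₂ (a , only) = λ c _ → ⁅ a ⁆ , ≤-trans (≤-reflexive (∣⁅x⁆∣≡1 a)) 1≤K ,
              elim-∅ λ b (_ , b∉) → b∉ (subst (_∈ ⁅ a ⁆) (sym (only b)) (x∈⁅x⁆ a))
    ...   | inj₁ occurs with ¬elim⇒wins B v ¬E
    ...     | a₀ , win = contradiction (f ∘ embed , hom-∘ {A = B} {A} {twisted} f-hom embed-hom) (no-hom isCore occurs)
      where
      open _IsCoreOf_ B-core
      open Twisted B a₀
      solution = solves A A∈𝒜 twisted (wins⇒strategy A twisted v
        (pullback retract v ∅ ∅ (λ {a} a∈ → contradiction (subst (a ∈_) dom-∅ a∈) ∉⊥) win))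
      f = proj₁ solution
      f-hom = proj₂ solution

  -- The code of a vertex lists the components in which the duplicator can be
  -- until the vertex is taken by the spoiler; a component is named by one of
  -- the vertices taken in it.
  record IsCoding (G : SimpleGraph (Fin n)) (k m : ℕ) (S : Pred (Fin n) 0ℓ)
                  (code : Fin n → List (Fin n)) : Set where
    open SimpleGraph G
    field
      code≤      : ∀ {a} → S a → length (code a) ≤ m
      code≢[]    : ∀ {a} → S a → code a ≢ []
      node       : ∀ {a} → S a → ∀ w c → w ∷ʳ c ⊑ code a → code c ≡ w ∷ʳ c × Walk G S a c
      comparable : ∀ {a b} → S a → S b → a ~ b → code a ⊑ code b ⊎ code b ⊑ code a
      fibre      : ∀ w → ∣ ⟦ (λ a → S a × code a ≡ w) ⟧ ∣ ≤ k

  ∣∅∣≤ : ∀ (P : Pred (Fin n) 0ℓ) → (∀ a → ¬ P a) → ∣ ⟦ P ⟧ ∣ ≤ k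
  ∣∅∣≤ {n} {k} P P∅ = ≤-trans (≤-reflexive (trans
    (cong ∣_∣ (Empty-unique λ (a , a∈) → P∅ a (∈⟦⟧⁻ a∈))) (∣⊥∣≡0 n))) z≤n

  module _ {G : SimpleGraph (Fin n)} where
    open SimpleGraph G

    -- One first move is fixed per component, through its representative. Vertices in the move get
    -- the component's name as their code; for the others that name is put before their code in the
    -- remaining game.
    elim⇒coding : 1 ≤ k → ∀ m {S} → Elim G (replicate m k) S → ∃ (IsCoding G k m S)
    elim⇒coding 1≤k zero {S} E = (λ _ → []) , record
      { code≤      = λ Sa → contradiction Sa (E _)
      ; code≢[]    = λ Sa → contradiction Sa (E _)
      ; node       = λ Sa → contradiction Sa (E _)
      ; comparable = λ Sa → contradiction Sa (E _)
      ; fibre      = λ w → ∣∅∣≤ (λ a → S a × [] ≡ w) λ a (Sa , _) → E a Sa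
      }
    elim⇒coding {k} 1≤k (suc m) {S} E = code , record
      { code≤      = code≤
      ; code≢[]    = λ _ ()
      ; node       = node
      ; comparable = comparable
      ; fibre      = fibre
      }
      where
      Local : Fin n → Subset n → Fin n → (Fin n → List (Fin n)) → Set
      Local c X d code = d ∈ X × Walk G S c d × ∣ X ∣ ≤ k ×
                         IsCoding G k m (λ a → Walk G S c a × a ∉ X) code

      local : ∀ c → S c → ∃ λ X → ∃₂ λ d code → Local c X d code
      local c Sc with E c Sc
      ... | X , X≤k , EX with em {∃ λ d → d ∈ X × Walk G S c d}
      ...   | yes (d , d∈X , w) = let code , coding = elim⇒coding 1≤k m EX in
              X , d , code , d∈X , w , X≤k , coding
      -- A move that misses the component is replaced by `c` alone, so that some deleted vertex can
      -- name the component.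
      ...   | no none = let code , coding = elim⇒coding 1≤k m
                              (elim-⊆ (λ (w , _) → w , λ a∈X → none (_ , a∈X , w)) EX) in
              ⁅ c ⁆ , c , code , x∈⁅x⁆ c , stay Sc , ≤-trans (≤-reflexive (∣⁅x⁆∣≡1 c)) 1≤k , coding

      total : ∀ c → ∃ λ X → ∃₂ λ d code → S c → Local c X d code
      total c with em {S c}
      ... | yes Sc = let X , d , code , l = local c Sc in X , d , code , λ _ → l
      ... | no ¬Sc = ⊥ , c , (λ _ → []) , λ Sc → contradiction Sc ¬Sc

      X : Fin n → Subset n
      X c = proj₁ (total c)

      top : Fin n → Fin n
      top c = proj₁ (proj₂ (total c))

      inner : Fin n → Fin n → List (Fin n)
      inner c = proj₁ (proj₂ (proj₂ (total c)))

      rest : Fin n → Fin n → List (Fin n)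
      rest c a with a ∈? X c
      ... | yes _ = []
      ... | no  _ = inner c a

      code : Fin n → List (Fin n)
      code a = top (rep G S a) ∷ rest (rep G S a) a

      properties : ∀ {c} → S c → Local c (X c) (top c) (inner c)
      properties {c} = proj₂ (proj₂ (proj₂ (total c)))

      module I {c} (Sc : S c) = IsCoding (proj₂ (proj₂ (proj₂ (properties Sc))))

      rest-in : ∀ {c a} → a ∈ X c → rest c a ≡ []
      rest-in {c} {a} a∈ with a ∈? X c
      ... | yes _  = refl
      ... | no  a∉ = contradiction a∈ a∉

      rest-out : ∀ {c a} → a ∉ X c → rest c a ≡ inner c a
      rest-out {c} {a} a∉ with a ∈? X c
      ... | yes a∈ = contradiction a∈ a∉
      ... | no  _  = refl

      code-at : ∀ {a c} → rep G S a ≡ c → code a ≡ top c ∷ rest c a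
      code-at refl = refl

      to-rep : ∀ {a} → S a → Walk G S (rep G S a) a
      to-rep Sa = walk-sym (rep-walk G S Sa)

      rep∈ : ∀ {a} → S a → S (rep G S a)
      rep∈ Sa = source∈ (to-rep Sa)

      rep-idem : ∀ {a} → S a → rep G S (rep G S a) ≡ rep G S a
      rep-idem Sa = rep-cong G S (to-rep Sa)

      to-top : ∀ {a} → S a → Walk G S a (top (rep G S a))
      to-top Sa = walk-trans (rep-walk G S Sa) (proj₁ (proj₂ (properties (rep∈ Sa))))

      code≤ : ∀ {a} → S a → length (code a) ≤ suc m
      code≤ {a} Sa with a ∈? X (rep G S a)
      ... | yes _  = s≤s z≤n
      ... | no  a∉ = s≤s (I.code≤ (rep∈ Sa) (to-rep Sa , a∉))

      node : ∀ {a} → S a → ∀ w c → w ∷ʳ c ⊑ code a → code c ≡ w ∷ʳ c × Walk G S a c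
      node {a} Sa [] c (v , eq) with ∷-injectiveˡ eq
      ... | refl = trans (code-at (sym (rep-cong G S (to-top Sa))))
                     (cong (c ∷_) (rest-in (proj₁ (properties (rep∈ Sa)))))
                 , to-top Sa
      node {a} Sa (d ∷ w) c (v , eq) with ∷-injective eq
      ... | refl , eq′ with a ∈? X (rep G S a)
      ...   | yes _  = contradiction (++-conicalˡ (w ∷ʳ c) v eq′) (∷ʳ≢[] w)
      ...   | no  a∉ = let code≡ , w₁ = I.node (rep∈ Sa) (to-rep Sa , a∉) w c (v , eq′)
                           w₂ , c∉ = target∈ w₁ in
              trans (code-at (trans (sym (rep-cong G S w₂)) (rep-idem Sa)))
                    (cong (d ∷_) (trans (rest-out c∉) code≡))
            , walk-trans (rep-walk G S Sa) w₂

      comparable : ∀ {a b} → S a → S b → a ~ b → code a ⊑ code b ⊎ code b ⊑ code a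
      comparable {a} {b} Sa Sb e
        with rep G S b | rep-cong G S (move Sa e (stay Sb)) | to-rep Sb
      ... | _ | refl | wb with a ∈? X (rep G S a) | b ∈? X (rep G S a)
      ...   | yes _  | _      = inj₁ (⊑-∷ _ (_ , refl))
      ...   | no  _  | yes _  = inj₂ (⊑-∷ _ (_ , refl))
      ...   | no  a∉ | no  b∉ = [ inj₁ ∘ ⊑-∷ _ , inj₂ ∘ ⊑-∷ _ ]′
              (I.comparable (rep∈ Sa) (to-rep Sa , a∉) (wb , b∉) e)

      fibre : ∀ w → ∣ ⟦ (λ a → S a × code a ≡ w) ⟧ ∣ ≤ k
      fibre []      = ∣∅∣≤ (λ a → S a × code a ≡ []) λ { a (_ , ()) }
      fibre (x ∷ w) with em {S x}
      ... | no ¬Sx = ∣∅∣≤ (λ a → S a × code a ≡ x ∷ w) λ { a (Sa , refl) → ¬Sx (target∈ (to-top Sa)) }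
      ... | yes Sx = bound w
        where
        c = rep G S x

        at-c : ∀ {a w} → S a → code a ≡ x ∷ w → rep G S a ≡ c
        at-c Sa refl = rep-cong G S (to-top Sa)

        from-c : ∀ {a w} → S a → code a ≡ x ∷ w → Walk G S c a
        from-c {a} Sa eq = subst (λ c → Walk G S c a) (at-c Sa eq) (to-rep Sa)

        rest≡ : ∀ {a w} → S a → code a ≡ x ∷ w → rest c a ≡ w
        rest≡ Sa eq = ∷-injectiveʳ (trans (sym (code-at (at-c Sa eq))) eq)

        bound : ∀ w → ∣ ⟦ (λ a → S a × code a ≡ x ∷ w) ⟧ ∣ ≤ k
        bound [] = ≤-trans (p⊆q⇒∣p∣≤∣q∣ in-X) (proj₁ (proj₂ (proj₂ (properties (rep∈ Sx)))))
          where
          in-X : ⟦ (λ a → S a × code a ≡ x ∷ []) ⟧ ⊆ X c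
          in-X {a} a∈ with ∈⟦⟧⁻ a∈
          ... | Sa , eq with a ∈? X c
          ...   | yes a∈X = a∈X
          ...   | no  a∉X = contradiction (trans (sym (rest-out a∉X)) (rest≡ Sa eq))
                              (I.code≢[] (rep∈ Sx) (from-c Sa eq , a∉X))
        bound (y ∷ w) = ≤-trans (p⊆q⇒∣p∣≤∣q∣ in-inner) (I.fibre (rep∈ Sx) (y ∷ w))
          where
          in-inner : ⟦ (λ a → S a × code a ≡ x ∷ y ∷ w) ⟧ ⊆
                     ⟦ (λ a → (Walk G S c a × a ∉ X c) × inner c a ≡ y ∷ w) ⟧
          in-inner {a} a∈ with ∈⟦⟧⁻ a∈
          ... | Sa , eq with a ∈? X c
          ...   | yes a∈X = contradiction (trans (sym (rest-in a∈X)) (rest≡ Sa eq)) λ ()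
          ...   | no  a∉X = ∈⟦⟧⁺ ((from-c Sa eq , a∉X) , trans (sym (rest-out a∉X)) (rest≡ Sa eq))

  -- The forest of a coding

  module Coded {G : SimpleGraph (Fin n)} {k m} {code : Fin n → List (Fin n)}
               (coding : IsCoding G k m Everything code) where
    open IsCoding coding
    private
      module G = SimpleGraph G

    -- Nodes are the vertices that name components. The forest lives on all of `Fin n`, and vertices
    -- that are not nodes are isolated in it.
    Node : Fin n → Set
    Node a = ∃ λ w → code a ≡ w ∷ʳ a

    Child : Fin n → Fin n → Set
    Child a b = ∃ λ w → code a ≡ w ∷ʳ a × code b ≡ (w ∷ʳ a) ∷ʳ b

    depth : Fin n → ℕ
    depth = length ∘ code

    depth-child : ∀ {a b} → Child a b → depth b ≡ suc (depth a)
    depth-child {a} {b} (w , eqa , eqb) =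
      trans (cong length eqb) (trans (length-∷ʳ (w ∷ʳ a) b) (cong (suc ∘ length) (sym eqa)))

    parent-unique : ∀ {a a′ b} → Child a b → Child a′ b → a ≡ a′
    parent-unique (w , _ , eq) (w′ , _ , eq′) =
      proj₂ (∷ʳ-injective w w′ (proj₁ (∷ʳ-injective _ _ (trans (sym eq) eq′))))

    child-⊑ : ∀ {a b} → Child a b → code a ⊑ code b
    child-⊑ {a} {b} (w , eqa , eqb) = b ∷ [] , trans (cong (_∷ʳ b) eqa) (sym eqb)

    child-≢ : ∀ {a b} → Child a b → a ≢ b
    child-≢ c refl = m≢1+n+m _ {0} (depth-child c)

    forest : SimpleGraph (Fin n)
    forest = record
      { _~_      = λ a b → Child a b ⊎ Child b a
      ; ~-sym    = swap
      ; ~-irrefl = λ { eq (inj₁ c) → child-≢ c eq ; eq (inj₂ c) → child-≢ c (sym eq) }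
      }

    top : ∀ a → ∃ λ t → Node t × code t ≡ code a
    top a with code a in eq
    ... | l with initLast l
    ...   | []      = contradiction eq (code≢[] tt)
    ...   | w ∷ʳ′ c = let code≡ , _ = node {a} tt w c (subst (w ∷ʳ c ⊑_) (sym eq) ⊑-refl) in
            c , (w , code≡) , code≡

    node-≡ : ∀ {a b} → Node a → Node b → code a ≡ code b → a ≡ b
    node-≡ (w , eq) (w′ , eq′) eq″ = proj₂ (∷ʳ-injective w w′ (trans (sym eq) (trans eq″ eq′)))

    parent : ∀ {h g} → Node h → code g ⊑ code h → code g ≢ code h →
             ∃ λ p → Child p h × Node p × code g ⊑ code p
    parent {h} {g} (w , eq) g⊑h g≢h with ⊑-∷ʳ (subst (code g ⊑_) eq g⊑h) (subst (code g ≢_) eq g≢h)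
    ... | g⊑w with initLast w
    ...   | [] = contradiction (++-conicalˡ (code g) _ (proj₂ g⊑w)) (code≢[] tt)
    ...   | w′ ∷ʳ′ p = let code≡ , _ = node {h} tt w′ p (h ∷ [] , sym eq) in
            p , (w′ , code≡ , eq) , (w′ , code≡) , subst (code g ⊑_) (sym code≡) g⊑w

    Between : Fin n → Fin n → Pred (Fin n) 0ℓ
    Between g h x = Node x × code g ⊑ code x × code x ⊑ code h

    -- Passing to the parent removes the last letter of the code, so the walk up from `h` ends at
    -- the node with the code of `g`.
    climb : ∀ {g h t} → Node h → Node t → code t ≡ code g → code g ⊑ code h →
            Walk forest (Between g h) h t
    climb {g} {h} {t} Nh Nt t≡g g⊑h =
      go (depth h) h ≤-refl (Nh , g⊑h , ⊑-refl)
      where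
      go : ∀ d x → depth x ≤ d → Between g h x → Walk forest (Between g h) x t
      go d x x≤d B@(Nx , g⊑x , x⊑h) with em {code g ≡ code x}
      ... | yes g≡x = subst (λ y → Walk forest (Between g h) x y) (node-≡ Nx Nt (trans (sym g≡x) (sym t≡g))) (stay B)
      ... | no  g≢x with parent Nx g⊑x g≢x
      go zero    x x≤0 B | no g≢x | p , c , _ = contradiction (subst (_≤ 0) (depth-child c) x≤0) λ ()
      go (suc d) x x≤d B@(Nx , g⊑x , x⊑h) | no g≢x | p , c , Np , g⊑p =
        move B (inj₂ c) (go d p (≤-pred (subst (_≤ suc d) (depth-child c) x≤d))
          (Np , g⊑p , ⊑-trans (child-⊑ c) x⊑h))

    module Restricted (S : Subset n) = ParentRelation (induced forest S)
      (λ a b → Child (proj₁ a) (proj₁ b)) (depth ∘ proj₁) id depth-child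
      (λ c c′ → member≡ (parent-unique c c′))

  -- Deconstructions and tree depth from a coding

  elim⇒deconstruction : ∀ {r} (G : Graph) → 1 ≤ k → Elim (graph G) (replicate (suc r) k) Everything →
                        ∃ λ H → ForestsOfHeight≤ r H ×
                        ∃ λ (D : Deconstruction H G) → Width≤ H G D (suc (suc r) * k + suc (suc r) * k)
  elim⇒deconstruction {k} {r} G 1≤k E with elim⇒coding 1≤k (suc r) E
  ... | code , coding = H , (acyclic , height) , D , width
    where
    open IsCoding coding
    open Coded coding
    open ParentRelation forest Child depth id depth-child parent-unique using (acyclic)

    H : Graph
    H = record { order = Graph.order G ; nonEmpty = Graph.nonEmpty G ; graph = forest }

    local-root : ∀ S x d → x ∈ S → depth x ≤ d → ∃ λ z → z ∈ S × (∀ y → y ∈ S → ¬ Child y z)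
    local-root S x d x∈S x≤d with em {∃ λ y → y ∈ S × Child y x}
    ... | no none = x , x∈S , λ y y∈S c → none (y , y∈S , c)
    local-root S x zero    x∈S x≤d | yes (y , y∈S , c) = contradiction (subst (_≤ 0) (depth-child c) x≤d) λ ()
    local-root S x (suc d) x∈S x≤d | yes (y , y∈S , c) =
      local-root S y d y∈S (≤-pred (subst (_≤ suc d) (depth-child c) x≤d))

    height : ∀ S → IsComponent forest S → TreeHeight≤ (induced forest S) r
    height S ((x , x∈S) , _) with local-root S x (depth x) x∈S ≤-refl
    -- Codes have between 1 and `suc r` letters, so a descending path has at most `r` edges.
    ... | z , z∈S , no-parent = (z , z∈S) , λ {n} p s → ≤-pred (begin
        suc n         ≡⟨ +-comm 1 n ⟩
        n + 1         ≤⟨ +-monoʳ-≤ n depth≥1 ⟩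
        n + depth z   ≤⟨ Restricted.rooted-height S (λ (y , y∈S) → no-parent y y∈S) (λ _ → code≤ tt) p s ⟩
        suc r         ∎)
      where
      open ≤-Reasoning
      depth≥1 : 1 ≤ depth z
      depth≥1 with code z in eq
      ... | []    = contradiction eq (code≢[] tt)
      ... | _ ∷ _ = s≤s z≤n

    -- The bag of a node collects what was deleted on the way to it, so vertices with comparable
    -- codes share a bag. Other vertices, being isolated, get empty bags, which keeps locations
    -- connected.
    bag : Fin (Graph.order G) → Subset (Graph.order G)
    bag h = ⟦ (λ a → Node h × code a ⊑ code h) ⟧

    D : Deconstruction H G
    D = record { bag = bag ; covers = covers ; connected = connected }
      where
      covers : ∀ g g′ → ReflClosure (SimpleGraph._~_ (graph G)) g g′ →
               ∃₂ λ h h′ → ReflClosure (SimpleGraph._~_ forest) h h′ ×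
                           g ∈ bag h ∪ bag h′ × g′ ∈ bag h ∪ bag h′
      covers g g′ g~g′ = both (upper g~g′)
        where
        upper : ReflClosure (SimpleGraph._~_ (graph G)) g g′ → ∃ λ x → code g ⊑ code x × code g′ ⊑ code x
        upper refl  = g , ⊑-refl , ⊑-refl
        upper [ e ] = [ (λ g⊑g′ → g′ , g⊑g′ , ⊑-refl) , (λ g′⊑g → g , ⊑-refl , g′⊑g) ]′ (comparable tt tt e)
        both : (∃ λ x → code g ⊑ code x × code g′ ⊑ code x) → _
        both (x , g⊑x , g′⊑x) with top x
        ... | t , Nt , t≡x = t , t , refl
            , x∈p∪q⁺ (inj₁ (∈⟦⟧⁺ (Nt , subst (code g ⊑_) (sym t≡x) g⊑x)))
            , x∈p∪q⁺ (inj₁ (∈⟦⟧⁺ (Nt , subst (code g′ ⊑_) (sym t≡x) g′⊑x)))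

      connected : ∀ g → Connected (induced forest (tabulate λ h → lookup (bag h) g))
      connected g (h , h∈) (h′ , h′∈) =
        walk⇒star (walk-trans (to-top h∈) (walk-sym (to-top h′∈))) h∈ h′∈
        where
        t = proj₁ (top g)
        to-top : ∀ {h} → h ∈ tabulate (λ h → lookup (bag h) g) →
                 Walk forest (_∈ tabulate (λ h → lookup (bag h) g)) h t
        to-top h∈ = let Nh , g⊑h = ∈⟦⟧⁻ (∈location⁻ bag h∈) in
          walk-mono (λ (Nx , g⊑x , _) → ∈location⁺ bag (∈⟦⟧⁺ (Nx , g⊑x)))
            (climb Nh (proj₁ (proj₂ (top g))) (proj₂ (proj₂ (top g))) g⊑h)

    -- A prefix of `code h` is determined by its length, for which `suc (suc r)` values are allowed,
    -- and each fibre has at most `k` elements.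
    bag≤ : ∀ h → ∣ bag h ∣ ≤ suc (suc r) * k
    bag≤ h = ≤-trans (p⊆q⇒∣p∣≤∣q∣ by-length) (∣⋃ᶠ∣≤ level (λ i → fibre (take (toℕ i) (code h))))
      where
      level : Fin (suc (suc r)) → Subset (Graph.order G)
      level i = ⟦ (λ a → Unit × code a ≡ take (toℕ i) (code h)) ⟧
      by-length : bag h ⊆ ⋃ᶠ level
      by-length {a} a∈ with ∈⟦⟧⁻ a∈
      ... | _ , a⊑h = ∈⋃ᶠ level i (∈⟦⟧⁺ (tt , trans (⊑⇒take a⊑h)
              (cong (λ l → take l (code h)) (sym (toℕ-fromℕ< (s≤s (code≤ tt)))))))
        where
        i = fromℕ< (s≤s (code≤ {a} tt))

    width : Width≤ H G D (suc (suc r) * k + suc (suc r) * k)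
    width h h′ _ = ≤-trans (∣p∪q∣≤∣p∣+∣q∣ (bag h) (bag h′)) (+-mono-≤ (bag≤ h) (bag≤ h′))

  -- With one vertex per move codes are injective and every vertex is a node, so the forest of the
  -- coding restricts to a tree on each component.
  elim⇒treeDepth : ∀ {M} (G : Graph) → Elim (graph G) (replicate M 1) Everything → TreeDepth≤ G M
  elim⇒treeDepth {M} G E S ((s , s∈S) , S-connected , S-closed) with elim⇒coding ≤-refl M E
  ... | code , coding = T , root , (T-connected , R.acyclic) , height , ancestors
    where
    open IsCoding coding
    open Coded coding
    module R = Restricted S
    open Path
    T : SimpleGraph (∃ λ x → x ∈ S)
    T = induced forest S

    code-injective : ∀ {a b} → code a ≡ code b → a ≡ b
    code-injective {a} {b} eq = ∣p∣≤1⇒≡ (fibre (code b)) (∈⟦⟧⁺ (tt , eq)) (∈⟦⟧⁺ (tt , refl))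

    is-node : ∀ a → Node a
    is-node a = let t , Nt , t≡a = top a in subst Node (code-injective t≡a) Nt

    closed : ∀ {a b} → a ∈ S → Walk (graph G) Everything a b → b ∈ S
    closed a∈S (stay _)     = a∈S
    closed a∈S (move _ e w) = closed (S-closed a∈S e) w

    between∈S : ∀ {g h x} → h ∈ S → Between g h x → x ∈ S
    between∈S {h = h} h∈S ((w , eq) , _ , x⊑h) =
      closed h∈S (proj₂ (node {h} tt w _ (subst (_⊑ code h) eq x⊑h)))

    connect : ∀ {a b} (a∈S : a ∈ S) (b∈S : b ∈ S) → code a ⊑ code b →
              Star (SimpleGraph._~_ T) (b , b∈S) (a , a∈S)
    connect {a} {b} a∈S b∈S a⊑b = walk⇒star
      (walk-mono (between∈S b∈S) (climb (is-node b) (is-node a) refl a⊑b)) b∈S a∈S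

    T-connected : Connected T
    T-connected x y = along (S-connected x y)
      where
      along : ∀ {x y} → Star (SimpleGraph._~_ (induced (graph G) S)) x y → Star (SimpleGraph._~_ T) x y
      along ε = ε
      along {x , x∈} (_◅_ {j = y , y∈} e es) =
        [ (λ x⊑y → star-reverse swap (connect x∈ y∈ x⊑y)) , connect y∈ x∈ ]′ (comparable tt tt e) ◅◅ along es

    root-data : ∃ λ c → c ∈ S × code c ≡ c ∷ []
    root-data with code s in eq
    ... | []    = contradiction eq (code≢[] tt)
    ... | c ∷ l = let code≡ , w = node {s} tt [] c (l , sym eq) in c , closed s∈S w , code≡

    root : ∃ λ x → x ∈ S
    root = proj₁ root-data , proj₁ (proj₂ root-data)

    no-parent : ∀ y → ¬ Child (proj₁ y) (proj₁ root)
    no-parent y (w , _ , eq) = contradiction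
      (proj₁ (∷ʳ-injective [] (w ∷ʳ proj₁ y) (trans (sym (proj₂ (proj₂ root-data))) eq))) (≢-sym (∷ʳ≢[] w))

    height : RootedHeight≤ T root M
    height {n} p s = ≤-trans (m≤m+n n _) (R.rooted-height no-parent (λ _ → code≤ tt) p s)

    -- A path from the root runs through the prefixes of its last code, one for each length from 1
    -- on; hence `u` stands at index `depth u` minus one.
    on-path : ∀ {n} (p : Path T n) → start p ≡ root → ∀ {u} → code u ⊑ code (proj₁ (end p)) →
              ∃ λ i → proj₁ (vertex p i) ≡ u
    on-path {n} p s {u} u⊑ = i , code-injective (⊑-unique (prefix p down i) u⊑ (begin
        depth (proj₁ (vertex p i))                ≡⟨ R.depth-along p down i ⟩
        toℕ i + depth (proj₁ (start p))           ≡⟨ cong₂ _+_ (toℕ-fromℕ< u-1<) root-depth ⟩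
        pred-depth + 1                            ≡⟨ +-comm pred-depth 1 ⟩
        suc pred-depth                            ≡⟨ suc-pred-depth ⟩
        depth u                                   ∎))
      where
      open ≡-Reasoning
      down = R.descend-from-root p (subst (λ x → ∀ y → ¬ Child (proj₁ y) (proj₁ x)) (sym s) no-parent)
      root-depth : depth (proj₁ (start p)) ≡ 1
      root-depth = trans (cong (depth ∘ proj₁) s) (cong length (proj₂ (proj₂ root-data)))
      pred-depth = pred (depth u)
      suc-pred-depth : suc pred-depth ≡ depth u
      suc-pred-depth with code u in eq
      ... | []    = contradiction eq (code≢[] tt)
      ... | _ ∷ _ = refl
      u-1< : pred-depth < suc n
      u-1< = subst₂ _≤_ (sym suc-pred-depth)
        (trans (R.depth-end p down) (trans (cong (n +_) root-depth) (+-comm n 1))) (⊑-length u⊑)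
      i = fromℕ< u-1<
      prefix : ∀ {n} (p : Path T n) →
               (∀ i → Child (proj₁ (vertex p (inject₁ i))) (proj₁ (vertex p (suc i)))) →
               ∀ i → code (proj₁ (vertex p i)) ⊑ code (proj₁ (end p))
      prefix {zero}  p down zero    = ⊑-refl
      prefix {suc n} p down zero    = ⊑-trans (child-⊑ (down zero)) (prefix (tail p) (down ∘ suc) zero)
      prefix {suc n} p down (suc i) = prefix (tail p) (down ∘ suc) i

    ancestor : ∀ u w → code (proj₁ u) ⊑ code (proj₁ w) → Ancestor T root u w
    ancestor u w u⊑w with walk⇒path member-≡⊎≢ (star⇒walk (T-connected root w))
    ... | n , p , s , e , _ =
      let i , eq = on-path p s (subst (λ x → code (proj₁ u) ⊑ code (proj₁ x)) (sym e) u⊑w)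
      in n , p , s , e , i , member≡ eq

    ancestors : ∀ u w → SimpleGraph._~_ (induced (graph G) S) u w → Ancestor T root u w ⊎ Ancestor T root w u
    ancestors u w e = [ inj₁ ∘ ancestor u w , inj₂ ∘ ancestor w u ]′ (comparable tt tt e)

  -- Tree minors defeat the spoiler

  model⇒minor : ∀ (G : Graph) {x} → TreeModel (graph G) k h Everything x → completeTree h k MinorOf G
  model⇒minor {k} {h} G model = record
    { branch    = λ w → ⟦ branch (toList w) ⟧
    ; nonempty  = λ w → let a , a∈ = nonempty (toList w) (bound w) in a , ∈⟦⟧⁺ a∈
    ; connected = λ w (a , a∈) (b , b∈) → walk⇒star
        (walk-mono ∈⟦⟧⁺ (connected (toList w) (bound w) (∈⟦⟧⁻ a∈) (∈⟦⟧⁻ b∈))) a∈ b∈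
    ; disjoint  = λ w w′ ne (a , a∈) → let a∈w , a∈w′ = x∈p∩q⁻ _ _ a∈ in
        ne (toList-injective w w′ (disjoint (toList w) (toList w′) (bound w) (bound w′) (∈⟦⟧⁻ a∈w) (∈⟦⟧⁻ a∈w′)))
    ; edge      = λ { t s (inj₁ (i , eq)) →
                        let a , b , a∈ , b∈ , e = child-edge t s i eq in a , b , ∈⟦⟧⁺ a∈ , ∈⟦⟧⁺ b∈ , e
                    ; s t (inj₂ (i , eq)) →
                        let a , b , a∈ , b∈ , e = child-edge t s i eq
                        in b , a , ∈⟦⟧⁺ b∈ , ∈⟦⟧⁺ a∈ , SimpleGraph.~-sym (graph G) e }
    }
    where
    open TreeModel model
    bound : (w : Vec≤ (Fin k) h) → length (toList w) ≤ h
    bound w = subst (_≤ h) (sym (length-toList (Vec≤.vec w))) (isBounded w)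

    child-edge : ∀ (t s : Vec≤ (Fin k) h) i → toList s ≡ toList t ∷ʳ i →
                 ∃₂ λ a b → branch (toList t) a × branch (toList s) b × SimpleGraph._~_ (graph G) a b
    child-edge t s i eq rewrite eq = edge (toList t) i (subst (λ w → length w ≤ h) eq (bound s))

  module _ {G : SimpleGraph (Fin n)} {C x l} (model : TreeModel G k h C x) (l<k : l < k) where
    open TreeModel model

    Subtree : List (Fin k) → Pred (Fin n) 0ℓ
    Subtree w a = ∃ λ u → length (w ++ u) ≤ h × branch (w ++ u) a

    branch⊆subtree : ∀ {w a} → length w ≤ h → branch w a → Subtree w a
    branch⊆subtree {w} {a} w≤h wa =
      [] , subst (λ v → length v ≤ h × branch v a) (sym (++-identityʳ w)) (w≤h , wa)

    child-subtree : ∀ {w i a} → Subtree (w ∷ʳ i) a → Subtree w a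
    child-subtree {w} {i} {a} (u , wu) =
      i ∷ u , subst (λ v → length v ≤ h × branch v a) (++-assoc w (i ∷ []) u) wu

    subtree-walk : ∀ w u {c a} → length (w ++ u) ≤ h → branch w c → branch (w ++ u) a → Walk G (Subtree w) c a
    subtree-walk w [] {c} {a} w≤h wc wa with subst (λ v → length v ≤ h × branch v a) (++-identityʳ w) (w≤h , wa)
    ... | w≤h′ , wa′ = walk-mono (branch⊆subtree w≤h′) (connected w w≤h′ wc wa′)
    subtree-walk w (i ∷ u) {c} {a} wu≤h wc wa
      with subst (λ v → length v ≤ h × branch v a) (sym (++-assoc w (i ∷ []) u)) (wu≤h , wa)
    ... | wiu≤h , wiu-a =
      let wi≤h = ≤-trans (⊑-length {u = w ∷ʳ i} (u , refl)) wiu≤h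
          w≤h  = ≤-trans (⊑-length {u = w} (i ∷ [] , refl)) wi≤h
          p , q , wp , wiq , p~q = edge w i wi≤h
      in walk-trans (walk-mono (branch⊆subtree w≤h) (connected w w≤h wc wp))
           (move (branch⊆subtree w≤h wp) p~q
             (walk-mono child-subtree (subtree-walk (w ∷ʳ i) u wiu≤h wiq wiu-a)))

    subtrees-disjoint : ∀ {w i j a} → Subtree (w ∷ʳ i) a → Subtree (w ∷ʳ j) a → i ≡ j
    subtrees-disjoint {w} {i} {j} iA jA with child-subtree′ iA | child-subtree′ jA
      where
      child-subtree′ : ∀ {i a} → Subtree (w ∷ʳ i) a → ∃ λ u → length (w ++ i ∷ u) ≤ h × branch (w ++ i ∷ u) a
      child-subtree′ {i} {a} (u , wu) = u , subst (λ v → length v ≤ h × branch v a) (++-assoc w (i ∷ []) u) wu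
    ... | u , u≤h , ua | u′ , u′≤h , u′a =
      ∷-injectiveˡ (++-cancelˡ w (i ∷ u) (j ∷ u′) (disjoint _ _ u≤h u′≤h ua u′a))

    -- The subtrees below the `k` children are disjoint, so fewer than `k` vertices cannot meet them
    -- all.
    untouched-child : ∀ w (X : Subset n) → ∣ X ∣ ≤ l → ∃ λ i → ∀ a → Subtree (w ∷ʳ i) a → a ∉ X
    untouched-child w X X≤l with em {∃ λ i → ∀ a → Subtree (w ∷ʳ i) a → a ∉ X}
    ... | yes found = found
    ... | no  none  = contradiction
          (≤-trans (injection⇒≤∣p∣ (proj₁ ∘ touched) touched-injective X (λ i → proj₂ (proj₂ (touched i)))) X≤l)
          (<⇒≱ l<k)
      where
      touched : ∀ i → ∃ λ a → Subtree (w ∷ʳ i) a × a ∈ X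
      touched i with em {∃ λ a → Subtree (w ∷ʳ i) a × a ∈ X}
      ... | yes found = found
      ... | no  none′ = contradiction (i , λ a sub a∈X → none′ (a , sub , a∈X)) none
      touched-injective : ∀ {i j} → proj₁ (touched i) ≡ proj₁ (touched j) → i ≡ j
      touched-injective {i} {j} eq = subtrees-disjoint {w} (proj₁ (proj₂ (touched i)))
        (subst (Subtree (w ∷ʳ j)) (sym eq) (proj₁ (proj₂ (touched j))))

    -- The invariant is that the whole subtree at `w` survives. Each round the duplicator stays with
    -- an untouched child, one level further down.
    model⇒¬elim : ∀ m w {S} → length w + m ≤ h → (∀ {a} → Subtree w a → S a) → ¬ Elim G (replicate m l) S
    model⇒¬elim zero w w+0≤h sub⊆S E =
      let w≤h = subst (_≤ h) (+-identityʳ (length w)) w+0≤h ; a , wa = nonempty w w≤h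
      in E a (sub⊆S (branch⊆subtree w≤h wa))
    model⇒¬elim (suc m) w w+m≤h sub⊆S E
      with nonempty w (≤-trans (m≤m+n (length w) (suc m)) w+m≤h)
    ... | c , wc with E c (sub⊆S (branch⊆subtree (≤-trans (m≤m+n (length w) (suc m)) w+m≤h) wc))
    ...   | X , X≤l , EX with untouched-child w X X≤l
    ...     | i , untouched = model⇒¬elim m (w ∷ʳ i)
                (subst (_≤ h) (trans (+-suc (length w) m) (cong (_+ m) (sym (length-∷ʳ w i)))) w+m≤h)
                (λ wi → walk-mono sub⊆S (walk-into wi) , untouched _ wi) EX
      where
      walk-into : ∀ {a} → Subtree (w ∷ʳ i) a → Walk G (Subtree w) c a
      walk-into wi = let u , u≤h , ua = child-subtree {w} wi in subtree-walk w u u≤h wc ua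

  -- From failing elimination to tree minors

  -- One vertex on top, together with first moves in at most `k` components, each within the budget
  -- for the level below.
  budget : ℕ → ℕ → ℕ
  budget k zero    = 0
  budget k (suc d) = suc (k * budget k d)

  budget-mono : ∀ {k} → 1 ≤ k → ∀ d → budget k d ≤ budget k (suc d)
  budget-mono {k} 1≤k d = m≤n⇒m≤1+n (begin
    budget k d      ≡⟨ *-identityˡ (budget k d) ⟨
    1 * budget k d  ≤⟨ *-monoˡ-≤ (budget k d) 1≤k ⟩
    k * budget k d  ∎)
    where open ≤-Reasoning

  module _ {G : SimpleGraph (Fin n)} where
    open SimpleGraph G

    -- Greedy choice: vertices of `P` from new components are added until there are `j` of them or
    -- none is left.
    separated-or-covered : (S P : Pred (Fin n) 0ℓ) → ∀ j →
      (∃ λ (f : Fin j → Fin n) → (∀ i → P (f i)) × (∀ i i′ → i ≢ i′ → ¬ Walk G S (f i) (f i′))) ⊎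
      (∃₂ λ j′ (f : Fin j′ → Fin n) → j′ < j × (∀ i → P (f i)) × (∀ {a} → P a → ∃ λ i → Walk G S (f i) a))
    separated-or-covered S P zero = inj₁ ((λ ()) , (λ ()) , λ ())
    separated-or-covered S P (suc j) with separated-or-covered S P j
    ... | inj₂ (j′ , f , j′<j , covered) = inj₂ (j′ , f , m≤n⇒m≤1+n j′<j , covered)
    ... | inj₁ (f , Pf , apart) with em {∃ λ a → P a × ∀ i → ¬ Walk G S (f i) a}
    ...   | yes (a , Pa , new) = inj₁
            ( (λ { zero → a ; (suc i) → f i })
            , (λ { zero → Pa ; (suc i) → Pf i })
            , λ { zero    zero     ne → contradiction refl ne
                ; zero    (suc i′) ne → new i′ ∘ walk-sym
                ; (suc i) zero     ne → new i
                ; (suc i) (suc i′) ne → apart i i′ (ne ∘ cong suc) } )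
    ...   | no none = inj₂ (j , f , ≤-refl , Pf , covered)
      where
      covered : ∀ {a} → P a → ∃ λ i → Walk G S (f i) a
      covered {a} Pa with em {∃ λ i → Walk G S (f i) a}
      ... | yes found = found
      ... | no  none′ = contradiction (a , Pa , λ i w → none′ (i , w)) none

    leaf-model : ∀ {C : Pred (Fin n) 0ℓ} {x} → C x → TreeModel G k 0 C x
    leaf-model {C = C} {x} Cx = record
      { branch    = λ _ → _≡ x
      ; root∈     = refl
      ; within    = λ { _ _ refl → Cx }
      ; nonempty  = λ _ _ → x , refl
      ; connected = λ { _ _ refl refl → stay refl }
      ; disjoint  = λ { [] [] _ _ _ _ → refl }
      ; edge      = λ { [] _ () ; (_ ∷ _) _ () }
      }

    -- `Y` becomes the root branch, and the model in each `D i` is hung below it by an edge at `r`.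
    join-models : ∀ {C Y : Pred (Fin n) 0ℓ} {x r} → Y x → Y r → (∀ {a} → Y a → C a) →
                  (∀ {a} → Y a → Walk G Y r a) →
                  (D : Fin k → Pred (Fin n) 0ℓ) → (∀ i {a} → D i a → C a × ¬ Y a) →
                  (∀ {i j a} → D i a → D j a → i ≡ j) →
                  (∀ i → ∃ λ y → r ~ y × TreeModel G k m (D i) y) → TreeModel G k (suc m) C x
    join-models {k = k} {m = m} {C} {Y} {x} {r} Yx Yr Y⊆C Y-conn D D⊆ D-disjoint sub = record
      { branch    = branch
      ; root∈     = Yx
      ; within    = λ { [] _ Ya → Y⊆C Ya ; (i ∷ w) (s≤s w≤m) a∈ → proj₁ (D⊆ i (M.within i w w≤m a∈)) }
      ; nonempty  = λ { [] _ → x , Yx ; (i ∷ w) (s≤s w≤m) → M.nonempty i w w≤m }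
      ; connected = λ { [] _ Ya Yb → walk-trans (walk-sym (Y-conn Ya)) (Y-conn Yb)
                      ; (i ∷ w) (s≤s w≤m) → M.connected i w w≤m }
      ; disjoint  = disjoint
      ; edge      = λ { [] i _ → let y , r~y , _ = sub i in r , y , Yr , M.root∈ i , r~y
                      ; (j ∷ w) i (s≤s w≤m) → M.edge j w i w≤m }
      }
      where
      module M i = TreeModel (proj₂ (proj₂ (sub i)))
      branch : List (Fin k) → Pred (Fin n) 0ℓ
      branch []      = Y
      branch (i ∷ w) = M.branch i w
      disjoint : ∀ w w′ → length w ≤ suc m → length w′ ≤ suc m → ∀ {a} → branch w a → branch w′ a → w ≡ w′
      disjoint []      []        _ _ _ _ = refl
      disjoint []      (j ∷ w′)  _ (s≤s w′≤) Ya a∈ = contradiction Ya (proj₂ (D⊆ j (M.within j w′ w′≤ a∈)))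
      disjoint (i ∷ w) []        (s≤s w≤) _ a∈ Ya = contradiction Ya (proj₂ (D⊆ i (M.within i w w≤ a∈)))
      disjoint (i ∷ w) (j ∷ w′)  (s≤s w≤) (s≤s w′≤) a∈ a∈′
        with D-disjoint (M.within i w w≤ a∈) (M.within j w′ w′≤ a∈′)
      ... | refl = cong (i ∷_) (M.disjoint i w w′ w≤ w′≤ a∈ a∈′)

    -- Merging `Y` into the root branch, across the edge from `r` to `y`, makes that branch contain
    -- `x`.
    enlarge-root : ∀ {C D Y : Pred (Fin n) 0ℓ} {x y r} → Y x → Y r → r ~ y → (∀ {a} → Y a → C a) →
                   (∀ {a} → Y a → Walk G Y r a) → (∀ {a} → D a → C a × ¬ Y a) →
                   TreeModel G k h D y → TreeModel G k h C x
    enlarge-root {k = k} {h = h} {C} {D} {Y} {x} {y} {r} Yx Yr r~y Y⊆C Y-conn D⊆ model = record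
      { branch    = branch
      ; root∈     = inj₁ Yx
      ; within    = within
      ; nonempty  = λ { [] _ → x , inj₁ Yx ; w@(_ ∷ _) → M.nonempty w }
      ; connected = λ { [] _ a∈ b∈ → walk-trans (walk-sym (root-walk a∈)) (root-walk b∈)
                      ; w@(_ ∷ _) → M.connected w }
      ; disjoint  = disjoint
      ; edge      = λ { [] i i≤ → let a , b , a∈ , b∈ , e = M.edge [] i i≤ in a , b , inj₂ a∈ , b∈ , e
                      ; w@(_ ∷ _) → M.edge w }
      }
      where
      module M = TreeModel model
      branch : List (Fin k) → Pred (Fin n) 0ℓ
      branch []        a = Y a ⊎ M.branch [] a
      branch w@(_ ∷ _)   = M.branch w
      within : ∀ w → length w ≤ h → ∀ {a} → branch w a → C a
      within []        w≤ (inj₁ Ya) = Y⊆C Ya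
      within []        w≤ (inj₂ a∈) = proj₁ (D⊆ (M.within [] w≤ a∈))
      within w@(_ ∷ _) w≤ a∈        = proj₁ (D⊆ (M.within w w≤ a∈))
      root-walk : ∀ {a} → branch [] a → Walk G (branch []) r a
      root-walk (inj₁ Ya) = walk-mono inj₁ (Y-conn Ya)
      root-walk (inj₂ a∈) = move (inj₁ Yr) r~y (walk-mono inj₂ (M.connected [] z≤n M.root∈ a∈))
      disjoint : ∀ w w′ → length w ≤ h → length w′ ≤ h → ∀ {a} → branch w a → branch w′ a → w ≡ w′
      disjoint []        []         _  _   _         _         = refl
      disjoint []        w@(_ ∷ _)  w≤ w′≤ (inj₁ Ya) a∈        = contradiction Ya (proj₂ (D⊆ (M.within w w′≤ a∈)))
      disjoint []        w@(_ ∷ _)  w≤ w′≤ (inj₂ a∈) a∈′       = M.disjoint [] w w≤ w′≤ a∈ a∈′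
      disjoint w@(_ ∷ _) []         w≤ w′≤ a∈        (inj₁ Ya) = contradiction Ya (proj₂ (D⊆ (M.within w w≤ a∈)))
      disjoint w@(_ ∷ _) []         w≤ w′≤ a∈        (inj₂ a∈′) = M.disjoint w [] w≤ w′≤ a∈ a∈′
      disjoint w@(_ ∷ _) w′@(_ ∷ _) w≤ w′≤ a∈        a∈′       = M.disjoint w w′ w≤ w′≤ a∈ a∈′

    -- Let r be the first vertex to be eliminated. If the spoiler fails in more
    -- than k components of C without r, then r connects models found there,
    -- except possibly one containing x, which goes to the root branch.
    -- Otherwise either she fails, with one round more, in one of these at most
    -- k components, or her first moves in all of them, together with r, are a
    -- good first move in C.
    ¬elim⇒model : 1 ≤ k → ∀ d m {C : Pred (Fin n) 0ℓ} {x} → C x → (∀ {a} → C a → Walk G C x a) →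
                  Elim G (replicate d 1) C → ¬ Elim G (replicate m (budget k d)) C → TreeModel G k m C x
    ¬elim⇒model 1≤k d       zero    Cx C-conn E ¬E = leaf-model Cx
    ¬elim⇒model 1≤k zero    (suc m) Cx C-conn E ¬E = contradiction Cx (E _)
    ¬elim⇒model {k} 1≤k (suc d) (suc m) {C} {x} Cx C-conn E ¬E with E x Cx
    ... | X , X≤1 , EX with em {∃ λ r → C r × r ∈ X}
    -- The deletion misses `C`, so one round of the elimination is saved.
    ...   | no none = ¬elim⇒model 1≤k d (suc m) Cx C-conn
              (elim-⊆ (λ Ca → C-conn Ca , λ a∈X → none (_ , Ca , a∈X)) EX)
              (¬E ∘ elim-budget (suc m) (budget-mono 1≤k d))
    ...   | yes (r , Cr , r∈X) = by-components (separated-or-covered S Fails (suc k))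
      where
      S : Pred (Fin n) 0ℓ
      S a = C a × a ≢ r

      E′ : ∀ {S′ : Pred (Fin n) 0ℓ} → (∀ {a} → S′ a → S a) → Elim G (replicate d 1) S′
      E′ S′⊆S = elim-⊆ (λ S′a → let Ca , a≢r = S′⊆S S′a in
        C-conn Ca , λ a∈X → a≢r (∣p∣≤1⇒≡ X≤1 a∈X r∈X)) EX

      Component : Fin n → Pred (Fin n) 0ℓ
      Component c = Walk G S c

      Fails : Pred (Fin n) 0ℓ
      Fails c = S c × ¬ Elim G (replicate m (budget k d)) (Component c)

      from-r : ∀ {a} → S a → ∃ λ y → r ~ y × Component a y
      from-r (Ca , a≢r) =
        let y , r~y , w = exit ≡⊎≢ (walk-trans (walk-sym (C-conn Cr)) (C-conn Ca)) a≢r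
        in y , r~y , walk-sym w

      component-conn : ∀ {c y} → Component c y → ∀ {a} → Component c a → Walk G (Component c) y a
      component-conn cy ca = walk-trans (walk-sym (walk-within cy)) (walk-within ca)

      many : (f : Fin (suc k) → Fin n) → (∀ i → Fails (f i)) →
             (∀ i i′ → i ≢ i′ → ¬ Component (f i) (f i′)) → TreeModel G k (suc m) C x
      many f fails apart = join-models {Y = Y} Yx (inj₁ refl) Y⊆C Y-conn
        (λ i → Component (f (punchIn i₀ i)))
        (λ i fa → proj₁ (target∈ fa) , Y-apart i fa)
        (λ {i} {j} fi fj → punchIn-injective i₀ i j (same (punchIn i₀ i) (punchIn i₀ j)
                               (walk-trans fi (walk-sym fj))))
        (λ i → let Sf , ¬Ef = fails (punchIn i₀ i) ; y , r~y , fy = from-r Sf in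
          y , r~y , ¬elim⇒model 1≤k d m fy (component-conn fy) (E′ target∈) ¬Ef)
        where
        same : ∀ i j → Component (f i) (f j) → i ≡ j
        same i j fij with i ≟ᶠ j
        ... | yes eq = eq
        ... | no  ne = contradiction fij (apart i j ne)

        Y : Pred (Fin n) 0ℓ
        Y a = a ≡ r ⊎ Component x a

        Yx : Y x
        Yx with ≡⊎≢ x r
        ... | inj₁ x≡r = inj₁ x≡r
        ... | inj₂ x≢r = inj₂ (stay (Cx , x≢r))

        Y⊆C : ∀ {a} → Y a → C a
        Y⊆C (inj₁ refl) = Cr
        Y⊆C (inj₂ xa)   = proj₁ (target∈ xa)

        Y-conn : ∀ {a} → Y a → Walk G Y r a
        Y-conn (inj₁ refl) = stay (inj₁ refl)
        Y-conn (inj₂ xa)   = let y , r~y , xy = from-r (source∈ xa) in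
          move (inj₁ refl) r~y (walk-mono inj₂ (component-conn xy xa))

        avoid : ∃ λ i₀ → ∀ i → i ≢ i₀ → ¬ Component (f i) x
        avoid with em {∃ λ i₀ → Component (f i₀) x}
        ... | yes (i₀ , fx) = i₀ , λ i i≢i₀ fx′ → apart i i₀ i≢i₀ (walk-trans fx′ (walk-sym fx))
        ... | no  none      = zero , λ i _ fx → none (i , fx)

        i₀ = proj₁ avoid

        Y-apart : ∀ i {a} → Component (f (punchIn i₀ i)) a → ¬ Y a
        Y-apart i fa (inj₁ a≡r) = proj₂ (target∈ fa) a≡r
        Y-apart i fa (inj₂ xa)  = proj₂ avoid (punchIn i₀ i) (punchInᵢ≢i i₀ i) (walk-trans fa (walk-sym xa))

      descend : ∀ c → S c → ¬ Elim G (replicate (suc m) (budget k d)) (Component c) → TreeModel G k (suc m) C x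
      descend c Sc ¬Ec with em {Component c x}
      ... | yes cx = widen (¬elim⇒model 1≤k d (suc m) cx (component-conn cx) (E′ target∈) ¬Ec)
        where
        widen : TreeModel G k (suc m) (Component c) x → TreeModel G k (suc m) C x
        widen model = record { TreeModel model ; within = λ w w≤ a∈ → proj₁ (target∈ (TreeModel.within model w w≤ a∈)) }
      -- Here `x` is elsewhere; all of `C` outside this component is connected through `r` and goes
      -- to the root branch.
      ... | no ¬cx = let y , r~y , cy = from-r Sc in
        enlarge-root {Y = Y} (Cx , ¬cx) Yr r~y proj₁ Y-conn
          (λ ca → proj₁ (target∈ ca) , λ (_ , ¬ca) → ¬ca ca)
          (¬elim⇒model 1≤k d (suc m) cy (component-conn cy) (E′ target∈) ¬Ec)
        where
        Y : Pred (Fin n) 0ℓ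
        Y a = C a × ¬ Component c a

        Yr : Y r
        Yr = Cr , λ cr → proj₂ (target∈ cr) refl

        Y-conn : ∀ {a} → Y a → Walk G Y r a
        Y-conn {a} (Ca , ¬ca) with ≡⊎≢ a r
        ... | inj₁ refl = stay Yr
        ... | inj₂ a≢r  = let y , r~y , ay = from-r (Ca , a≢r) in
          move Yr r~y (walk-mono (λ ab → proj₁ (target∈ ab) , λ cb → ¬ca (walk-trans cb (walk-sym ab)))
            (walk-sym (walk-within ay)))

      few : ∀ {j} (f : Fin j → Fin n) → j ≤ k → (∀ i → Fails (f i)) →
            (∀ {a} → Fails a → ∃ λ i → Component (f i) a) →
            (∀ i → Elim G (replicate (suc m) (budget k d)) (Component (f i))) →
            Elim G (replicate (suc m) (budget k (suc d))) C
      few {j} f j≤k fails covered Ef c Cc = move-set , move-set≤ , elim-componentwise rest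
        where
        move-at : ∀ i → _
        move-at i = Ef i (f i) (stay (proj₁ (fails i)))

        move-set : Subset n
        move-set = ⁅ r ⁆ ∪ ⋃ᶠ (proj₁ ∘ move-at)

        move-set≤ : ∣ move-set ∣ ≤ budget k (suc d)
        move-set≤ = begin
          ∣ move-set ∣                               ≤⟨ ∣p∪q∣≤∣p∣+∣q∣ ⁅ r ⁆ (⋃ᶠ (proj₁ ∘ move-at)) ⟩
          ∣ ⁅ r ⁆ ∣ + ∣ ⋃ᶠ (proj₁ ∘ move-at) ∣      ≤⟨ +-mono-≤ (≤-reflexive (∣⁅x⁆∣≡1 r))
                                                          (∣⋃ᶠ∣≤ (proj₁ ∘ move-at) (λ i → proj₁ (proj₂ (move-at i)))) ⟩
          suc (j * budget k d)                       ≤⟨ s≤s (*-monoˡ-≤ (budget k d) j≤k) ⟩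
          suc (k * budget k d)                       ∎
          where open ≤-Reasoning

        Remaining : Pred (Fin n) 0ℓ
        Remaining a = Walk G C c a × a ∉ move-set

        remaining⊆S : ∀ {a} → Remaining a → S a
        remaining⊆S (w , a∉) = target∈ w , λ { refl → a∉ (x∈p∪q⁺ (inj₁ (x∈⁅x⁆ r))) }

        rest : ∀ a → Remaining a → Elim G (replicate m (budget k (suc d))) (Walk G Remaining a)
        -- A component where she already wins with `m` rounds needs no part of this move; in the
        -- others the winning first move is contained in it.
        rest a Ra with em {Elim G (replicate m (budget k d)) (Component a)}
        ... | yes Ea = elim-budget m (budget-mono 1≤k d) (elim-⊆ (walk-mono remaining⊆S) Ea)
        ... | no ¬Ea with covered (remaining⊆S Ra , ¬Ea)
        ...   | i , fa = elim-budget m (budget-mono 1≤k d)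
                  (elim-⊆ (λ w → walk-within (walk-trans fa (walk-mono remaining⊆S w))
                               , λ b∈ → proj₂ (target∈ w) (x∈p∪q⁺ (inj₂ (∈⋃ᶠ (proj₁ ∘ move-at) i b∈))))
                          (proj₂ (proj₂ (move-at i))))

      by-components : _ → TreeModel G k (suc m) C x
      by-components (inj₁ (f , fails , apart)) = many f fails apart
      by-components (inj₂ (j , f , s≤s j≤k , fails , covered))
        with em {∃ λ i → ¬ Elim G (replicate (suc m) (budget k d)) (Component (f i))}
      ... | yes (i , ¬Ei) = descend (f i) (proj₁ (fails i)) ¬Ei
      ... | no none = contradiction (few f j≤k fails covered Ef) ¬E
        where
        Ef : ∀ i → Elim G (replicate (suc m) (budget k d)) (Component (f i))
        Ef i with em {Elim G (replicate (suc m) (budget k d)) (Component (f i))}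
        ... | yes Ei = Ei
        ... | no ¬Ei = contradiction (i , ¬Ei) none

  -- The three conditions and elimination

  eliminable⇒solves : ∀ {r} (𝒜 : StructureClass ℓ) → Eliminable (CoreGraphs 𝒜) r →
                      ∃ λ (v : Vec ℕ (suc r)) → GameSolves v 𝒜
  eliminable⇒solves {r = r} 𝒜 (k , 1≤k , E) = replicate (suc r) k , solves
    where
    solves : GameSolves (replicate (suc r) k) 𝒜
    solves A A∈𝒜 B strategy with core-exists A
    ... | C , C-core = f ∘ proj₁ retract , hom-∘ {A = A} {C} {B} f-hom (proj₂ retract)
      where
      open _IsCoreOf_ C-core
      solution = elim⇒hom C B 1≤k (E _ (coreGraph A∈𝒜 C-core))
        (pullback (embed , embed-hom) (replicate (suc r) k) ∅ ∅
          (λ {a} a∈ → contradiction (subst (a ∈_) dom-∅ a∈) ∉⊥)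
          (strategy⇒wins A B (replicate (suc r) k) strategy))
      f = proj₁ solution
      f-hom = proj₂ solution

  eliminable⇒≼ : ∀ {r} (𝒢 : GraphClass ℓ) → Eliminable 𝒢 r → 𝒢 ≼ ForestsOfHeight≤ r
  eliminable⇒≼ {r = r} 𝒢 (k , 1≤k , E) =
    suc (suc r) * k + suc (suc r) * k ,
    ≤-trans 1≤k (≤-trans (m≤m+n k (suc r * k)) (m≤m+n _ _)) ,
    λ G G∈𝒢 → elim⇒deconstruction G 1≤k (E G G∈𝒢)

  ≼⇒eliminable : ∀ {r} (𝒢 : GraphClass ℓ) → 𝒢 ≼ ForestsOfHeight≤ r → Eliminable 𝒢 r
  ≼⇒eliminable 𝒢 (k , 1≤k , dec) = k , 1≤k , λ G G∈𝒢 →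
    let H , H-forest , D , width = dec G G∈𝒢 in deconstruction⇒elim H G H-forest D width

  eliminable⇒depths : ∀ {r} (𝒢 : GraphClass ℓ) → Eliminable 𝒢 r → BoundedTreeDepth 𝒢 × StackDepth≤ 𝒢 r
  eliminable⇒depths {r = r} 𝒢 (k , 1≤k , E) =
    (suc r * k , λ G G∈𝒢 → elim⇒treeDepth G (elim-singly k (suc r) (E G G∈𝒢))) , stack
    where
    stack : StackDepth≤ 𝒢 r
    stack h deep with h ≤? r
    ... | yes h≤r = h≤r
    -- Branching `suc k` exceeds the spoiler's budget by one, so an untouched child always exists.
    ... | no  h≰r with deep (suc k) (s≤s z≤n)
    ...   | G , G∈𝒢 , minor with minor⇒model G minor
    ...     | x , model = contradiction (E G G∈𝒢) (model⇒¬elim model ≤-refl (suc r) [] (≰⇒> h≰r) (λ _ → tt))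

  -- As `suc r` is outside the stack depth set, for some `k` no graph of the class has the tree of
  -- height `suc r` and branching `k` as a minor; a failure of the spoiler would produce it.
  depths⇒eliminable : ∀ {r} → ExcludedMiddle (lsuc 0ℓ ⊔ˡ ℓ) → (𝒢 : GraphClass ℓ) →
                      BoundedTreeDepth 𝒢 → StackDepth≤ 𝒢 r → Eliminable 𝒢 r
  depths⇒eliminable {r = r} em⁺ 𝒢 (d , treeDepth≤d) stack
    with em⁺ {∃ λ k → 1 ≤ k × (∀ G → 𝒢 G → ¬ completeTree (suc r) k MinorOf G)}
  ... | no all = contradiction (stack (suc r) deep) 1+n≰n
    where
    deep : InStackDepthSet 𝒢 (suc r)
    deep k 1≤k with em⁺ {∃ λ G → 𝒢 G × completeTree (suc r) k MinorOf G}
    ... | yes found = found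
    ... | no  none  = contradiction (k , 1≤k , λ G G∈𝒢 minor → none (G , G∈𝒢 , minor)) all
  ... | yes (k , 1≤k , no-minor) = suc (budget k D) , s≤s z≤n , λ G G∈𝒢 →
        elim-budget (suc r) (n≤1+n _) (elim-componentwise {G = graph G} {ps = replicate (suc r) (budget k D)}
          λ c _ → in-component G G∈𝒢 c)
    where
    -- Tree depth at most `d` gives `suc d` rounds of `suc d` vertices each, played here one vertex
    -- at a time.
    D = suc d * suc d
    in-component : ∀ G → 𝒢 G → ∀ c → Elim (graph G) (replicate (suc r) (budget k D)) (Walk (graph G) Everything c)
    in-component G G∈𝒢 c with em {Elim (graph G) (replicate (suc r) (budget k D)) (Walk (graph G) Everything c)}
    ... | yes E = E
    ... | no ¬E = contradiction (model⇒minor G record { TreeModel model ; within = λ _ _ _ → tt }) (no-minor G G∈𝒢)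
      where
      model : TreeModel (graph G) k (suc r) (Walk (graph G) Everything c) c
      model = ¬elim⇒model 1≤k D (suc r) (stay tt) walk-within
        (elim-⊆ {ps = replicate D 1} (λ _ → tt) (elim-singly (suc d) (suc d) (treeDepth⇒elim G (treeDepth≤d G G∈𝒢)))) ¬E

lower-em : ∀ {ℓ} → ExcludedMiddle (lsuc 0ℓ ⊔ˡ ℓ) → ExcludedMiddle 0ℓ
lower-em {ℓ} em {P} = map′ lower lift (em {Lift (lsuc 0ℓ ⊔ˡ ℓ) P})

theorem6p3 : ∀ {ℓ : Level} → ExcludedMiddle (lsuc 0ℓ ⊔ˡ ℓ) →
    (𝒜 : StructureClass ℓ) (r : ℕ) →
    ((∃ λ (v : Vec ℕ (suc r)) → GameSolves v 𝒜) ⇔ (CoreGraphs 𝒜 ≼ ForestsOfHeight≤ r))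
    × ((CoreGraphs 𝒜 ≼ ForestsOfHeight≤ r) ⇔ (BoundedTreeDepth (CoreGraphs 𝒜) × StackDepth≤ (CoreGraphs 𝒜) r))
theorem6p3 {ℓ} em 𝒜 r =
    mk⇔ (λ (v , solves) → eliminable⇒≼ 𝒢 (solves⇒elim 𝒜 v solves))
        (λ 𝒢≼ℱ → eliminable⇒solves 𝒜 (≼⇒eliminable 𝒢 𝒢≼ℱ))
  , mk⇔ (λ 𝒢≼ℱ → eliminable⇒depths 𝒢 (≼⇒eliminable 𝒢 𝒢≼ℱ))
        (λ (td , sd) → eliminable⇒≼ 𝒢 (depths⇒eliminable em 𝒢 td sd))
  where
  𝒢 = CoreGraphs 𝒜
  open Classical (lower-em {ℓ} em)
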